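{- Let $H$ be a bipartite graph with $v$ vertices and $e$ edges, where $v\le e$. If $H$ satisfies the operator-norm Sidorenko certificate, then, for every graph $G$ with $M(G)=2e(G)>0$, $$\hom(H,G)\ge \lambda(G)^{2e-v}M(G)^{v-e}.$$
   Context: Graphs are finite and simple, with nonempty vertex set. $\hom(H,G)$ is the number of homomorphisms from $H$ to $G$; $e(G)$ is the number of edges of $G$; $\lambda(G)$ is the spectral radius of its adjacency matrix. For a real $n\times n$ matrix $A$ and $1\le p,r\le\infty$, $\|A\|_{p\to r}:=\sup_{x\neq0}\|Ax\|_r/\|x\|_p$. Operator-norm Sidorenko certificate: with $s_H:=\frac{2e}{v}$ and $s_H':=\frac{2e}{2e-v}$, $H$ satisfies the certificate if for every graph $G$ with adjacency matrix $A=A(G)$ one has $\hom(H,G)\ge\|A\|_{s_H'\to s_H}^{\,e}$. -}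

module Defs where

open import Algebra.Bundles using (CommutativeRing)
open import Algebra.Core using (Op₁; Op₂)
import Algebra.Construct.NaturalChoice.Max as Max
import Algebra.Properties.CommutativeMonoid.Sum as Sum
import Algebra.Properties.Semiring.Exp as Exp
import Algebra.Properties.Semiring.Mult as Mult
open import Algebra.Structures using (IsCommutativeRing)
open import Data.Fin.Base as Fin using (Fin; finToFun)
import Data.Fin.Properties as Fin
open import Data.Integer.Base as ℤ using (ℤ; +_; -[1+_])
open import Data.List.Base using (length; filter; map; allFin; cartesianProduct)
open import Data.Nat.Base as ℕ using (ℕ; suc; NonZero)
import Data.Nat.Properties as ℕ
open import Data.Bool.Base using (Bool; if_then_else_)
open import Data.Product.Base using (∃; ∃-syntax; _×_; _,_)
open import Data.Rational.Unnormalised.Base as ℚ using (ℚᵘ; ↥_; ↧ₙ_)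
open import Data.Sum.Base using (_⊎_)
open import Data.Vec.Functional using (Vector)
open import Level using (0ℓ)
open import Relation.Binary.Bundles using (TotalOrder)
open import Relation.Binary.Core using (Rel)
open import Relation.Binary.Definitions using (Decidable; Symmetric)
open import Relation.Binary.PropositionalEquality.Core using (_≢_)
open import Relation.Binary.Structures using (IsDecTotalOrder)
open import Relation.Nullary using (¬_; does)
open import Relation.Nullary.Decidable using (_×-dec_; _→-dec_)

-- The real numbers enter as an arbitrary complete ordered field, which
-- determines them up to isomorphism.  The axioms are the classical ones: a
-- decidable total order, and least upper bounds for arbitrary nonempty
-- bounded sets.  Both _⁻¹ and sup are total functions, and nothing is assumed
-- about the value of 0⁻¹ or about the sup of an empty or unbounded set.
record CompleteOrderedField : Set₁ where
  infix  4 _≈_ _≤_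
  infixl 6 _+_
  infixl 7 _*_
  infix  8 -_
  infix  9 _⁻¹
  field
    Carrier           : Set
    _≈_ _≤_           : Rel Carrier 0ℓ
    _+_ _*_           : Op₂ Carrier
    -_ _⁻¹            : Op₁ Carrier
    0# 1#             : Carrier
    isCommutativeRing : IsCommutativeRing _≈_ _+_ _*_ -_ 0# 1#
    0≉1               : ¬ (0# ≈ 1#)
    ⁻¹-cong           : ∀ {x y} → x ≈ y → x ⁻¹ ≈ y ⁻¹
    *-inverseʳ        : ∀ {x} → ¬ (x ≈ 0#) → x * x ⁻¹ ≈ 1#
    isDecTotalOrder   : IsDecTotalOrder _≈_ _≤_
    +-monoʳ-≤         : ∀ x {y z} → y ≤ z → x + y ≤ x + z
    *-nonNegative     : ∀ {x y} → 0# ≤ x → 0# ≤ y → 0# ≤ x * y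

  IsUpperBound : (Carrier → Set) → Carrier → Set
  IsUpperBound P b = ∀ {x} → P x → x ≤ b

  IsLeastUpperBound : (Carrier → Set) → Carrier → Set
  IsLeastUpperBound P s =
    IsUpperBound P s × (∀ {b} → IsUpperBound P b → s ≤ b)

  field
    sup          : (Carrier → Set) → Carrier
    sup-complete : ∀ P → ∃ P → ∃ (IsUpperBound P) →
                   IsLeastUpperBound P (sup P)

  commutativeRing : CommutativeRing 0ℓ 0ℓ
  commutativeRing = record { isCommutativeRing = isCommutativeRing }

  totalOrder : TotalOrder 0ℓ 0ℓ 0ℓ
  totalOrder = record
    { isTotalOrder = IsDecTotalOrder.isTotalOrder isDecTotalOrder }

record Graph : Set₁ where
  infix 4 _∼_ _∼?_
  field
    order         : ℕ
    order-nonZero : NonZero order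
    _∼_           : Rel (Fin order) 0ℓ
    _∼?_          : Decidable _∼_
    ∼-sym         : Symmetric _∼_
    ∼-irrefl      : ∀ {i} → ¬ (i ∼ i)

open Graph public using (order)

size : Graph → ℕ
size G = length (filter edge? (cartesianProduct (allFin (order G)) (allFin (order G))))
  where
  open Graph G using (_∼?_)
  edge? = λ ((i , j) : Fin (order G) × Fin (order G)) → (i Fin.<? j) ×-dec (i ∼? j)

Bipartite : Graph → Set
Bipartite G = ∃ λ (side : Fin (order G) → Bool) → ∀ {i j} → i ∼ j → side i ≢ side j
  where open Graph G using (_∼_)

IsHomomorphism : (H G : Graph) → (Fin (order H) → Fin (order G)) → Set
IsHomomorphism H G f = ∀ i j → i ∼H j → f i ∼G f j
  where
  open Graph H using () renaming (_∼_ to _∼H_)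
  open Graph G using () renaming (_∼_ to _∼G_)

-- finToFun enumerates every map between the vertex sets exactly once.
hom : Graph → Graph → ℕ
hom H G = length (filter isHom? (map finToFun (allFin (order G ℕ.^ order H))))
  where
  open Graph H using () renaming (_∼?_ to _∼H?_)
  open Graph G using () renaming (_∼?_ to _∼G?_)
  isHom? = λ (f : Fin (order H) → Fin (order G)) →
    Fin.all? λ i → Fin.all? λ j → (i ∼H? j) →-dec (f i ∼G? f j)

M : Graph → ℕ
M G = 2 ℕ.* size G

-- The certificate exponents 2e/v and 2e/(2e − v), for v < 2e.
module _ (H : Graph) where

  sExp : ℚᵘ
  sExp = ((+ (2 ℕ.* size H)) ℚ./ order H) {{Graph.order-nonZero H}}

  s′Exp : order H ℕ.< 2 ℕ.* size H → ℚᵘ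
  s′Exp v<2e = ((+ (2 ℕ.* size H)) ℚ./ (2 ℕ.* size H ℕ.∸ order H))
    {{ℕ.>-nonZero (ℕ.m<n⇒0<n∸m v<2e)}}

/-nonZero : ∀ m d .{{_ : NonZero m}} .{{_ : NonZero d}} → ℚ.NonZero ((+ m) ℚ./ d)
/-nonZero (suc m) (suc d) = _

v≤e⇒v<2e : ∀ H → order H ℕ.≤ size H → order H ℕ.< 2 ℕ.* size H
v≤e⇒v<2e H v≤e = ℕ.≤-<-trans v≤e (ℕ.m<m+n (size H) (ℕ.≤-trans 0<e (ℕ.m≤m+n (size H) 0)))
  where
  0<e : 0 ℕ.< size H
  0<e = ℕ.≤-trans (ℕ.>-nonZero⁻¹ (order H) {{Graph.order-nonZero H}}) v≤e

module Analysis (ℝ : CompleteOrderedField) where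

  open CompleteOrderedField ℝ public
    using (Carrier; _≈_; _≤_; _+_; _*_; -_; _⁻¹; 0#; 1#; sup)
  open CommutativeRing (CompleteOrderedField.commutativeRing ℝ)
    using (semiring; +-commutativeMonoid; _-_)
  open Exp semiring public using (_^_)
  open Mult semiring public using () renaming (_×_ to _·_)
  open Sum +-commutativeMonoid public using (sum)
  open Max (CompleteOrderedField.totalOrder ℝ) using (_⊔_)

  infixl 7 _/_
  _/_ : Op₂ Carrier
  x / y = x * y ⁻¹

  fromℕ : ℕ → Carrier
  fromℕ n = n · 1#

  ∣_∣ : Op₁ Carrier
  ∣ x ∣ = x ⊔ - x

  infixr 8 _^ℤ_ _^ℚ_
  _^ℤ_ : Carrier → ℤ → Carrier
  x ^ℤ (+ n)    = x ^ n
  x ^ℤ -[1+ n ] = (x ^ suc n) ⁻¹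

  -- The nonnegative n-th root of x, for 0 ≤ x and 1 ≤ n.
  root : ℕ → Carrier → Carrier
  root n x = sup λ y → 0# ≤ y × y ^ n ≤ x

  -- x to the power a/b is the b-th root of xᵃ; meaningful for 0 < x, and for
  -- x = 0 when the exponent is positive.
  _^ℚ_ : Carrier → ℚᵘ → Carrier
  x ^ℚ q = root (↧ₙ q) (x ^ℤ (↥ q))

  Matrix : ℕ → Set
  Matrix n = Fin n → Fin n → Carrier

  infixr 7 _*ᵥ_
  _*ᵥ_ : ∀ {n} → Matrix n → Vector Carrier n → Vector Carrier n
  (A *ᵥ x) i = sum λ j → A i j * x j

  norm : (p : ℚᵘ) .{{_ : ℚ.NonZero p}} → ∀ {n} → Vector Carrier n → Carrier
  norm p x = (sum λ i → ∣ x i ∣ ^ℚ p) ^ℚ (ℚ.1/ p)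

  opNorm : (p r : ℚᵘ) .{{_ : ℚ.NonZero p}} .{{_ : ℚ.NonZero r}} →
           ∀ {n} → Matrix n → Carrier
  opNorm p r A = sup λ t →
    ∃[ x ] ¬ (∀ i → x i ≈ 0#) × t ≈ norm r (A *ᵥ x) / norm p x

  -- a + b𝐢 is a complex eigenvalue of A, with eigenvector x + y𝐢.
  IsEigenvalue : ∀ {n} → Matrix n → Carrier → Carrier → Set
  IsEigenvalue A a b = ∃[ x ] ∃[ y ]
    ¬ ((∀ i → x i ≈ 0#) × (∀ i → y i ≈ 0#)) ×
    (∀ i → (A *ᵥ x) i ≈ a * x i - b * y i) ×
    (∀ i → (A *ᵥ y) i ≈ b * x i + a * y i)

  -- The supremum of the moduli of the complex eigenvalues is taken within
  -- [0,∞).  Adjoining 0 makes the set visibly nonempty, and does not affect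
  -- the supremum since moduli are nonnegative.
  spectralRadius : ∀ {n} → Matrix n → Carrier
  spectralRadius A = sup λ t →
    t ≈ 0# ⊎ (∃[ a ] ∃[ b ] IsEigenvalue A a b × t ≈ root 2 (a ^ 2 + b ^ 2))

  adjacency : (G : Graph) → Matrix (order G)
  adjacency G i j = if does (i ∼? j) then 1# else 0#
    where open Graph G using (_∼?_)

  Certificate : (H : Graph) → order H ℕ.< 2 ℕ.* size H → Set₁
  Certificate H v<2e = (G : Graph) →
    opNorm (s′Exp H v<2e) (sExp H) {{s′≢0}} {{s≢0}} (adjacency G) ^ size H
      ≤ fromℕ (hom H G)
    where
    n≢0 : NonZero (2 ℕ.* size H)
    n≢0 = ℕ.>-nonZero (ℕ.≤-<-trans ℕ.z≤n v<2e)
    s≢0 = /-nonZero (2 ℕ.* size H) (order H) {{n≢0}} {{Graph.order-nonZero H}}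
    s′≢0 = /-nonZero (2 ℕ.* size H) (2 ℕ.* size H ℕ.∸ order H)
      {{n≢0}} {{ℕ.>-nonZero (ℕ.m<n⇒0<n∸m v<2e)}}

{-# OPTIONS --safe #-}

-- Put m = 2e − v and N = 2e, so that the certificate exponents are p = N/m and
-- r = N/v, with 1/p + 1/r = 1, and let K be the norm of A from p to r.  As A is
-- symmetric, its eigenvalues are real and have real eigenvectors.  If A x = a x,
-- then u = |x| satisfies |a| ‖u‖₂² ≤ ⟨A u, u⟩.  Since A is a 0-1 matrix with M
-- ones and v ≤ e means m ≥ e, Jensen's inequality for the power m/e gives
--   ⟨A u, u⟩ᵐ ≤ ⟨A W, W⟩ᵉ Mᵐ⁻ᵉ   for W = u ^ (m/e),
-- while Hölder's inequality gives ⟨A W, W⟩ ≤ ‖A W‖_r ‖W‖_p ≤ K ‖W‖_p², where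
-- ‖W‖_p = ‖u‖₂ ^ (m/e).  Hence |a|ᵐ ≤ Kᵉ Mᵉ⁻ᵛ.  Fractional powers are expressed
-- through n-th roots, so that all exponents in the inequalities are natural.

module Submission where

open import Defs
open import Algebra.Bundles using (CommutativeRing)
import Algebra.Construct.NaturalChoice.Max as Max
import Algebra.Properties.CommutativeSemiring.Exp as Exp
import Algebra.Properties.Ring as RingProperties
import Algebra.Properties.Semiring.Mult as Mult
import Algebra.Properties.Semiring.Sum as Sum
import Algebra.Solver.Ring.NaturalCoefficients.Default as Solver
open import Data.Bool.Base using (if_then_else_; true; false)
open import Data.Fin.Base as Fin using (Fin; zero; suc)
import Data.Fin.Properties as Fin
open import Data.Integer.Base as ℤ using (+_)
import Data.Integer.Properties as ℤ
open import Data.List.Base as List using (length; filter; tabulate; allFin; cartesianProduct)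
import Data.List.Properties as List
open import Data.Nat.Base as ℕ using (ℕ; zero; suc)
import Data.Nat.Properties as ℕ
open import Data.Product.Base using (∃-syntax; _×_; _,_; proj₁; proj₂)
open import Data.Rational.Unnormalised.Base as ℚ using ()
open import Data.Sum.Base using (_⊎_; inj₁; inj₂)
open import Data.Vec.Functional using (Vector)
open import Function.Base using (id; _∘_; _$_)
open import Relation.Binary.Bundles using (TotalOrder)
open import Relation.Binary.Definitions using (Tri; tri<; tri≈; tri>)
open import Relation.Binary.PropositionalEquality.Core as ≡ using (_≡_)
import Relation.Binary.Reasoning.PartialOrder as PosetReasoning
open import Relation.Binary.Structures using (IsDecTotalOrder)
open import Relation.Nullary using (¬_; Dec; yes; no; contradiction; does)
open import Relation.Nullary.Decidable using (_×-dec_; dec-true; dec-false)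

-- The exponent m/e of the test vector is the one with p · (m/e) = 2, as N = 2e; this is what makes
-- its p-norm a 2-norm. Jensen's inequality is itself an instance of Hölder's: a 0-1 entry satisfies
-- A = Aᵉ Aᵐ⁻ᵉ, so one copy of it joins the summand and the other acts as the weight whose total is
-- M. Hölder's inequality is therefore proved in a homogeneous form with natural weights p and q,
-- from weighted AM-GM, which in turn follows by induction from 2xy ≤ x² + y². The other obstacle is
-- that `sup` is specified only on nonempty bounded sets. A root, an operator norm or a spectral
-- radius says nothing until its set has an explicit upper bound: 1 + x for a root of x, n² for the
-- quotients defining the operator norm, and, for the moduli of the eigenvalues, the m-th root of
-- the very estimate to be proved.

module OrderedField (ℝ : CompleteOrderedField) where

  open Analysis ℝ public
  open CompleteOrderedField ℝ public
    using (commutativeRing; totalOrder; 0≉1; *-inverseʳ; sup-complete;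
           IsUpperBound; +-monoʳ-≤; *-nonNegative; isDecTotalOrder)
  open CommutativeRing commutativeRing public
    using (refl; sym; trans; reflexive; +-cong; +-congˡ; +-congʳ; *-cong; *-congˡ; *-congʳ;
           +-comm; +-assoc; *-comm; *-assoc; +-identityˡ; +-identityʳ; *-identityˡ; *-identityʳ;
           zeroˡ; zeroʳ; distribˡ; -‿inverseʳ; -‿inverseˡ; -‿cong; commutativeSemiring;
           semiring; ring)
  open IsDecTotalOrder isDecTotalOrder public
    using (total; antisym; _≤?_; _≟_)
    renaming (refl to ≤-refl; reflexive to ≤-reflexive; trans to ≤-trans)
  open RingProperties ring public using (-‿distribˡ-*; -‿distribʳ-*; -‿involutive; -0#≈0#)
  open Exp commutativeSemiring public using (^-congˡ; ^-congʳ; ^-homo-*; ^-assocʳ; ^-distrib-*)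
  open Mult semiring public using (×-homo-+)
  open Sum semiring public using (sum-cong-≋; ∑-distrib-+; ∑-comm; *-distribˡ-sum; *-distribʳ-sum)
  open Max totalOrder public using (⊔-sel; ⊔-lub; x≤x⊔y; x≤y⊔x)
  open Solver commutativeSemiring public using (solve; _:=_; _:+_; _:*_; con)
  open PosetReasoning (TotalOrder.poset totalOrder) public

  -- Stable, being a negation; its laws are contrapositives of those of _≤_.
  infix 4 _<_
  _<_ : Carrier → Carrier → Set
  x < y = ¬ (y ≤ x)

  <⇒≤ : ∀ {x y} → x < y → x ≤ y
  <⇒≤ {x} {y} y≰x with total x y
  ... | inj₁ x≤y = x≤y
  ... | inj₂ y≤x = contradiction y≤x y≰x

  ≤-byContradiction : ∀ {x y} → ¬ (y < x) → x ≤ y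
  ≤-byContradiction {x} {y} y≮x with x ≤? y
  ... | yes x≤y = x≤y
  ... | no x≰y = contradiction x≰y y≮x

  ≤-<-trans : ∀ {x y z} → x ≤ y → y < z → x < z
  ≤-<-trans x≤y y<z z≤x = y<z (≤-trans z≤x x≤y)

  <-≤-trans : ∀ {x y z} → x < y → y ≤ z → x < z
  <-≤-trans x<y y≤z z≤x = x<y (≤-trans y≤z z≤x)

  -- Arithmetic of inequalities in an ordered field.

  +-mono-≤ : ∀ {x y u v} → x ≤ y → u ≤ v → x + u ≤ y + v
  +-mono-≤ {x} {y} {u} {v} x≤y u≤v = begin
    x + u ≤⟨ +-monoʳ-≤ x u≤v ⟩
    x + v ≈⟨ +-comm x v ⟩
    v + x ≤⟨ +-monoʳ-≤ v x≤y ⟩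
    v + y ≈⟨ +-comm v y ⟩
    y + v ∎

  +-monoˡ-≤ : ∀ z {x y} → x ≤ y → x + z ≤ y + z
  +-monoˡ-≤ z x≤y = +-mono-≤ x≤y ≤-refl

  +-nonNeg : ∀ {x y} → 0# ≤ x → 0# ≤ y → 0# ≤ x + y
  +-nonNeg 0≤x 0≤y = ≤-trans (≤-reflexive (sym (+-identityˡ 0#))) (+-mono-≤ 0≤x 0≤y)

  x≤x+y : ∀ {x y} → 0# ≤ y → x ≤ x + y
  x≤x+y {x} 0≤y = ≤-trans (≤-reflexive (sym (+-identityʳ x))) (+-monoʳ-≤ x 0≤y)

  x≤y+x : ∀ {x y} → 0# ≤ y → x ≤ y + x
  x≤y+x {x} {y} 0≤y = ≤-trans (x≤x+y 0≤y) (≤-reflexive (+-comm x y))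

  x+y-y≈x : ∀ x y → x + y + - y ≈ x
  x+y-y≈x x y = trans (+-assoc x y (- y)) (trans (+-congˡ (-‿inverseʳ y)) (+-identityʳ x))

  x-y+y≈x : ∀ x y → x + - y + y ≈ x
  x-y+y≈x x y = trans (+-assoc x (- y) y) (trans (+-congˡ (-‿inverseˡ y)) (+-identityʳ x))

  +-cancelʳ-≤ : ∀ z {x y} → x + z ≤ y + z → x ≤ y
  +-cancelʳ-≤ z {x} {y} x+z≤y+z = begin
    x             ≈⟨ x+y-y≈x x z ⟨
    x + z + - z   ≤⟨ +-monoˡ-≤ (- z) x+z≤y+z ⟩
    y + z + - z   ≈⟨ x+y-y≈x y z ⟩
    y             ∎

  -- Writing the larger side as `x + d` with a nonnegative slack `d` removes subtraction, so that
  -- the remaining identities hold in commutative semirings and are within reach of `solve`.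
  ≤⇒∃+ : ∀ {x y} → x ≤ y → ∃[ d ] 0# ≤ d × x + d ≈ y
  ≤⇒∃+ {x} {y} x≤y =
    y + - x
    , (+-cancelʳ-≤ x $ begin
         0# + x       ≈⟨ +-identityˡ x ⟩
         x            ≤⟨ x≤y ⟩
         y            ≈⟨ x-y+y≈x y x ⟨
         y + - x + x  ∎)
    , trans (+-comm x _) (x-y+y≈x y x)

  <⇒∃+ : ∀ {x y} → x < y → ∃[ d ] 0# < d × x + d ≈ y
  <⇒∃+ {x} {y} x<y with ≤⇒∃+ (<⇒≤ x<y)
  ... | d , _ , x+d≈y = d , (λ d≤0 → x<y (begin
    y      ≈⟨ x+d≈y ⟨
    x + d  ≤⟨ +-monoʳ-≤ x d≤0 ⟩
    x + 0# ≈⟨ +-identityʳ x ⟩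
    x      ∎)) , x+d≈y

  *-monoʳ-≤ : ∀ {z} → 0# ≤ z → ∀ {x y} → x ≤ y → z * x ≤ z * y
  *-monoʳ-≤ {z} 0≤z {x} {y} x≤y with ≤⇒∃+ x≤y
  ... | d , 0≤d , x+d≈y = begin
    z * x           ≤⟨ x≤x+y (*-nonNegative 0≤z 0≤d) ⟩
    z * x + z * d   ≈⟨ distribˡ z x d ⟨
    z * (x + d)     ≈⟨ *-congˡ x+d≈y ⟩
    z * y           ∎

  *-monoˡ-≤ : ∀ {z} → 0# ≤ z → ∀ {x y} → x ≤ y → x * z ≤ y * z
  *-monoˡ-≤ {z} 0≤z {x} {y} x≤y = begin
    x * z ≈⟨ *-comm x z ⟩
    z * x ≤⟨ *-monoʳ-≤ 0≤z x≤y ⟩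
    z * y ≈⟨ *-comm z y ⟩
    y * z ∎

  *-mono-≤ : ∀ {x y u v} → 0# ≤ u → 0# ≤ y → x ≤ y → u ≤ v → x * u ≤ y * v
  *-mono-≤ 0≤u 0≤y x≤y u≤v = ≤-trans (*-monoˡ-≤ 0≤u x≤y) (*-monoʳ-≤ 0≤y u≤v)

  neg-mono-≤ : ∀ {x y} → x ≤ y → - y ≤ - x
  neg-mono-≤ {x} {y} x≤y = +-cancelʳ-≤ (x + y) $ begin
    - y + (x + y)  ≈⟨ +-congˡ (+-comm x y) ⟩
    - y + (y + x)  ≈⟨ +-assoc _ _ _ ⟨
    - y + y + x    ≈⟨ +-congʳ (-‿inverseˡ y) ⟩
    0# + x         ≤⟨ +-monoʳ-≤ 0# x≤y ⟩
    0# + y         ≈⟨ +-congʳ (-‿inverseˡ x) ⟨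
    - x + x + y    ≈⟨ +-assoc _ _ _ ⟩
    - x + (x + y)  ∎

  x≤0⇒0≤-x : ∀ {x} → x ≤ 0# → 0# ≤ - x
  x≤0⇒0≤-x x≤0 = ≤-trans (≤-reflexive (sym -0#≈0#)) (neg-mono-≤ x≤0)

  neg-*-neg : ∀ x y → - x * - y ≈ x * y
  neg-*-neg x y = begin-equality
    - x * - y     ≈⟨ -‿distribˡ-* x (- y) ⟨
    - (x * - y)   ≈⟨ -‿cong (-‿distribʳ-* x y) ⟨
    - (- (x * y)) ≈⟨ -‿involutive (x * y) ⟩
    x * y         ∎

  square-nonNeg : ∀ x → 0# ≤ x * x
  square-nonNeg x with total 0# x
  ... | inj₁ 0≤x = *-nonNegative 0≤x 0≤x
  ... | inj₂ x≤0 = ≤-trans (*-nonNegative 0≤-x 0≤-x) (≤-reflexive (neg-*-neg x x))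
    where 0≤-x = x≤0⇒0≤-x x≤0

  0≤1 : 0# ≤ 1#
  0≤1 = ≤-trans (square-nonNeg 1#) (≤-reflexive (*-identityˡ 1#))

  0<1 : 0# < 1#
  0<1 1≤0 = 0≉1 (antisym 0≤1 1≤0)

  0<⇒≉0 : ∀ {x} → 0# < x → ¬ (x ≈ 0#)
  0<⇒≉0 0<x x≈0 = 0<x (≤-reflexive x≈0)

  0≤∧≉0⇒0< : ∀ {x} → 0# ≤ x → ¬ (x ≈ 0#) → 0# < x
  0≤∧≉0⇒0< 0≤x x≉0 x≤0 = x≉0 (antisym x≤0 0≤x)

  *-inverse-pos : ∀ {x} → 0# < x → x * x ⁻¹ ≈ 1#
  *-inverse-pos 0<x = *-inverseʳ (0<⇒≉0 0<x)

  ⁻¹-pos : ∀ {x} → 0# < x → 0# < x ⁻¹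
  ⁻¹-pos {x} 0<x x⁻¹≤0 = 0<1 (begin
    1#        ≈⟨ *-inverse-pos 0<x ⟨
    x * x ⁻¹  ≤⟨ *-monoʳ-≤ (<⇒≤ 0<x) x⁻¹≤0 ⟩
    x * 0#    ≈⟨ zeroʳ x ⟩
    0#        ∎)

  x*z*z⁻¹≈x : ∀ x {z} → 0# < z → x * z * z ⁻¹ ≈ x
  x*z*z⁻¹≈x x {z} 0<z = trans (*-assoc x z _) (trans (*-congˡ (*-inverse-pos 0<z)) (*-identityʳ x))

  x*z⁻¹*z≈x : ∀ x {z} → 0# < z → x * z ⁻¹ * z ≈ x
  x*z⁻¹*z≈x x {z} 0<z =
    trans (*-assoc x _ z) (trans (*-congˡ (trans (*-comm _ z) (*-inverse-pos 0<z))) (*-identityʳ x))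

  *-cancelʳ-≤ : ∀ {z} → 0# < z → ∀ {x y} → x * z ≤ y * z → x ≤ y
  *-cancelʳ-≤ {z} 0<z {x} {y} xz≤yz = begin
    x             ≈⟨ x*z*z⁻¹≈x x 0<z ⟨
    x * z * z ⁻¹  ≤⟨ *-monoˡ-≤ (<⇒≤ (⁻¹-pos 0<z)) xz≤yz ⟩
    y * z * z ⁻¹  ≈⟨ x*z*z⁻¹≈x y 0<z ⟩
    y             ∎

  *-cancelˡ-≤ : ∀ {z} → 0# < z → ∀ {x y} → z * x ≤ z * y → x ≤ y
  *-cancelˡ-≤ {z} 0<z {x} {y} zx≤zy = *-cancelʳ-≤ 0<z $ begin
    x * z ≈⟨ *-comm x z ⟩
    z * x ≤⟨ zx≤zy ⟩
    z * y ≈⟨ *-comm z y ⟩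
    y * z ∎

  *-pos : ∀ {x y} → 0# < x → 0# < y → 0# < x * y
  *-pos {x} {y} 0<x 0<y xy≤0 = 0<x (*-cancelʳ-≤ 0<y (≤-trans xy≤0 (≤-reflexive (sym (zeroˡ y)))))

  +-pos : ∀ {x y} → 0# < x → 0# ≤ y → 0# < x + y
  +-pos 0<x 0≤y = <-≤-trans 0<x (x≤x+y 0≤y)

  ^-nonNeg : ∀ n {x} → 0# ≤ x → 0# ≤ x ^ n
  ^-nonNeg zero    0≤x = 0≤1
  ^-nonNeg (suc n) 0≤x = *-nonNegative 0≤x (^-nonNeg n 0≤x)

  ^-pos : ∀ n {x} → 0# < x → 0# < x ^ n
  ^-pos zero    0<x = 0<1
  ^-pos (suc n) 0<x = *-pos 0<x (^-pos n 0<x)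

  ^-mono-≤ : ∀ n {x y} → 0# ≤ x → x ≤ y → x ^ n ≤ y ^ n
  ^-mono-≤ zero    0≤x x≤y = ≤-refl
  ^-mono-≤ (suc n) 0≤x x≤y =
    *-mono-≤ (^-nonNeg n 0≤x) (≤-trans 0≤x x≤y) x≤y (^-mono-≤ n 0≤x x≤y)

  -- If y < x, then xⁿ⁺¹ ≤ y yⁿ ≤ y xⁿ, and cancelling xⁿ > 0 gives x ≤ y. Roots and norms are
  -- compared below through this lemma, after raising both sides to a power that clears the roots.
  ^-cancel-≤ : ∀ n .{{_ : ℕ.NonZero n}} {x y} → 0# ≤ y → x ^ n ≤ y ^ n → x ≤ y
  ^-cancel-≤ (suc n) {x} {y} 0≤y xⁿ≤yⁿ = ≤-byContradiction λ y<x →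
    y<x $ *-cancelʳ-≤ (^-pos n (≤-<-trans 0≤y y<x)) $ begin
      x * x ^ n ≤⟨ xⁿ≤yⁿ ⟩
      y * y ^ n ≤⟨ *-monoʳ-≤ 0≤y (^-mono-≤ n 0≤y (<⇒≤ y<x)) ⟩
      y * x ^ n ∎

  0^n≈0 : ∀ n .{{_ : ℕ.NonZero n}} → 0# ^ n ≈ 0#
  0^n≈0 (suc n) = zeroˡ _

  1^n≈1 : ∀ n → 1# ^ n ≈ 1#
  1^n≈1 zero    = refl
  1^n≈1 (suc n) = trans (*-identityˡ _) (1^n≈1 n)

  ^-cancel-≈0 : ∀ n .{{_ : ℕ.NonZero n}} {x} → 0# ≤ x → x ^ n ≈ 0# → x ≈ 0#
  ^-cancel-≈0 n 0≤x xⁿ≈0 =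
    antisym (^-cancel-≤ n ≤-refl (≤-reflexive (trans xⁿ≈0 (sym (0^n≈0 n))))) 0≤x

  ^-injective : ∀ n .{{_ : ℕ.NonZero n}} {x y} → 0# ≤ x → 0# ≤ y → x ^ n ≈ y ^ n → x ≈ y
  ^-injective n 0≤x 0≤y xⁿ≈yⁿ =
    antisym (^-cancel-≤ n 0≤y (≤-reflexive xⁿ≈yⁿ)) (^-cancel-≤ n 0≤x (≤-reflexive (sym xⁿ≈yⁿ)))

  ^-^-comm : ∀ x m n → (x ^ m) ^ n ≈ (x ^ n) ^ m
  ^-^-comm x m n = begin-equality
    (x ^ m) ^ n     ≈⟨ ^-assocʳ x m n ⟩
    x ^ (m ℕ.* n)   ≈⟨ ^-congʳ x (ℕ.*-comm m n) ⟩
    x ^ (n ℕ.* m)   ≈⟨ ^-assocʳ x n m ⟨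
    (x ^ n) ^ m     ∎

  ^-monoʳ-≤ : ∀ {x} → 1# ≤ x → ∀ {m n} → m ℕ.≤ n → x ^ m ≤ x ^ n
  ^-monoʳ-≤ {x} 1≤x {n = zero}  ℕ.z≤n = ≤-refl
  ^-monoʳ-≤ {x} 1≤x {n = suc n} ℕ.z≤n = begin
    1#        ≈⟨ *-identityˡ 1# ⟨
    1# * 1#   ≤⟨ *-mono-≤ 0≤1 (≤-trans 0≤1 1≤x) 1≤x (^-monoʳ-≤ 1≤x {n = n} ℕ.z≤n) ⟩
    x * x ^ n ∎
  ^-monoʳ-≤ {x} 1≤x (ℕ.s≤s m≤n) = *-monoʳ-≤ (≤-trans 0≤1 1≤x) (^-monoʳ-≤ 1≤x m≤n)

  -- The cases differ because the negative of `+ 0` is again `+ 0`, where `^ℤ` takes an ordinary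
  -- power, while every other negative unfolds to an inverse.
  ^ℤ-inverse : ∀ n {x} → 0# < x → x ^ℤ (ℤ.- (+ n)) * x ^ n ≈ 1#
  ^ℤ-inverse zero    0<x = *-identityˡ 1#
  ^ℤ-inverse (suc n) 0<x = trans (*-comm _ _) (*-inverse-pos (^-pos (suc n) 0<x))

  fromℕ-nonNeg : ∀ n → 0# ≤ fromℕ n
  fromℕ-nonNeg zero    = ≤-refl
  fromℕ-nonNeg (suc n) = +-nonNeg 0≤1 (fromℕ-nonNeg n)

  fromℕ-+ : ∀ m n → fromℕ (m ℕ.+ n) ≈ fromℕ m + fromℕ n
  fromℕ-+ = ×-homo-+ 1#

  fromℕ-pos : ∀ n .{{_ : ℕ.NonZero n}} → 0# < fromℕ n
  fromℕ-pos (suc n) = +-pos 0<1 (fromℕ-nonNeg n)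

  1≤fromℕ : ∀ n .{{_ : ℕ.NonZero n}} → 1# ≤ fromℕ n
  1≤fromℕ (suc n) = x≤x+y (fromℕ-nonNeg n)

  -- Absolute values and finite sums.

  x≤∣x∣ : ∀ x → x ≤ ∣ x ∣
  x≤∣x∣ x = x≤x⊔y x (- x)

  -x≤∣x∣ : ∀ x → - x ≤ ∣ x ∣
  -x≤∣x∣ x = x≤y⊔x x (- x)

  ∣x∣-nonNeg : ∀ x → 0# ≤ ∣ x ∣
  ∣x∣-nonNeg x with total 0# x
  ... | inj₁ 0≤x = ≤-trans 0≤x (x≤∣x∣ x)
  ... | inj₂ x≤0 = ≤-trans (x≤0⇒0≤-x x≤0) (-x≤∣x∣ x)

  ∣x∣≤ : ∀ {x c} → x ≤ c → - x ≤ c → ∣ x ∣ ≤ c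
  ∣x∣≤ = ⊔-lub

  0≤x⇒∣x∣≈x : ∀ {x} → 0# ≤ x → ∣ x ∣ ≈ x
  0≤x⇒∣x∣≈x {x} 0≤x =
    antisym (∣x∣≤ ≤-refl (≤-trans (neg-mono-≤ 0≤x) (≤-trans (≤-reflexive -0#≈0#) 0≤x))) (x≤∣x∣ x)

  ∣x∣≈0⇒x≈0 : ∀ {x} → ∣ x ∣ ≈ 0# → x ≈ 0#
  ∣x∣≈0⇒x≈0 {x} ∣x∣≈0 =
    antisym (≤-trans (x≤∣x∣ x) (≤-reflexive ∣x∣≈0))
            (≤-trans (≤-reflexive (sym -0#≈0#))
              (≤-trans (neg-mono-≤ (≤-trans (-x≤∣x∣ x) (≤-reflexive ∣x∣≈0)))
                (≤-reflexive (-‿involutive x))))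

  ∣x∣*∣x∣≈x*x : ∀ x → ∣ x ∣ * ∣ x ∣ ≈ x * x
  ∣x∣*∣x∣≈x*x x with ⊔-sel x (- x)
  ... | inj₁ ∣x∣≈x  = *-cong ∣x∣≈x ∣x∣≈x
  ... | inj₂ ∣x∣≈-x = trans (*-cong ∣x∣≈-x ∣x∣≈-x) (neg-*-neg x x)

  -- Both sides are nonnegative and have the square (xy)², which avoids a case split on signs.
  ∣∣-* : ∀ x y → ∣ x ∣ * ∣ y ∣ ≤ ∣ x * y ∣
  ∣∣-* x y = ^-cancel-≤ 2 (∣x∣-nonNeg _) $ ≤-reflexive $ begin-equality
    (∣ x ∣ * ∣ y ∣) ^ 2                ≈⟨ solve 2 (λ a b → (a :* b) :* ((a :* b) :* con 1) := (a :* a) :* (b :* b)) refl ∣ x ∣ ∣ y ∣ ⟩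
    (∣ x ∣ * ∣ x ∣) * (∣ y ∣ * ∣ y ∣)  ≈⟨ *-cong (∣x∣*∣x∣≈x*x x) (∣x∣*∣x∣≈x*x y) ⟩
    (x * x) * (y * y)                  ≈⟨ solve 2 (λ a b → (a :* a) :* (b :* b) := (a :* b) :* (a :* b)) refl x y ⟩
    (x * y) * (x * y)                  ≈⟨ ∣x∣*∣x∣≈x*x (x * y) ⟨
    ∣ x * y ∣ * ∣ x * y ∣              ≈⟨ *-congˡ (*-identityʳ _) ⟨
    ∣ x * y ∣ ^ 2                      ∎

  sum-mono-≤ : ∀ {n} {f g : Vector Carrier n} → (∀ i → f i ≤ g i) → sum f ≤ sum g
  sum-mono-≤ {zero}  f≤g = ≤-refl
  sum-mono-≤ {suc n} f≤g = +-mono-≤ (f≤g zero) (sum-mono-≤ (f≤g ∘ suc))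

  sum-zero : ∀ n → sum {n} (λ _ → 0#) ≈ 0#
  sum-zero zero    = refl
  sum-zero (suc n) = trans (+-identityˡ _) (sum-zero n)

  sum-nonNeg : ∀ {n} {f : Vector Carrier n} → (∀ i → 0# ≤ f i) → 0# ≤ sum f
  sum-nonNeg {n} 0≤f = ≤-trans (≤-reflexive (sym (sum-zero n))) (sum-mono-≤ 0≤f)

  sum-const : ∀ n x → sum {n} (λ _ → x) ≈ fromℕ n * x
  sum-const zero    x = sym (zeroˡ x)
  sum-const (suc n) x = trans (+-congˡ (sum-const n x))
    (solve 2 (λ k x → x :+ k :* x := (con 1 :+ k) :* x) refl (fromℕ n) x)

  term≤sum : ∀ {n} {f : Vector Carrier n} → (∀ i → 0# ≤ f i) → ∀ i → f i ≤ sum f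
  term≤sum 0≤f zero    = x≤x+y (sum-nonNeg (0≤f ∘ suc))
  term≤sum 0≤f (suc i) = ≤-trans (term≤sum (0≤f ∘ suc) i) (x≤y+x (0≤f zero))

-- Existence of n-th roots.

module Roots (ℝ : CompleteOrderedField) where
  open OrderedField ℝ

  -- This is n Bⁿ⁻¹, the Lipschitz constant of the n-th power on [0, B], in the recursive form that
  -- the induction on n produces.
  lipschitz : ℕ → Carrier → Carrier
  lipschitz zero    B = 0#
  lipschitz (suc n) B = B * lipschitz n B + B ^ n

  lipschitz-nonNeg : ∀ n {B} → 0# ≤ B → 0# ≤ lipschitz n B
  lipschitz-nonNeg zero    0≤B = ≤-refl
  lipschitz-nonNeg (suc n) 0≤B = +-nonNeg (*-nonNegative 0≤B (lipschitz-nonNeg n 0≤B)) (^-nonNeg n 0≤B)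

  ^-lipschitz : ∀ n {B x h} → 0# ≤ x → 0# ≤ h → x + h ≤ B →
                (x + h) ^ n ≤ x ^ n + lipschitz n B * h
  ^-lipschitz zero    {B} {x} {h} 0≤x 0≤h x+h≤B = x≤x+y (≤-reflexive (sym (zeroˡ h)))
  ^-lipschitz (suc n) {B} {x} {h} 0≤x 0≤h x+h≤B = begin
    (x + h) * (x + h) ^ n                   ≤⟨ *-monoʳ-≤ 0≤x+h (^-lipschitz n 0≤x 0≤h x+h≤B) ⟩
    (x + h) * (x ^ n + L * h)               ≈⟨ solve 4 (λ x h p l → (x :+ h) :* (p :+ l :* h) := x :* p :+ ((x :+ h) :* l :+ p) :* h) refl x h (x ^ n) L ⟩
    x * x ^ n + ((x + h) * L + x ^ n) * h   ≤⟨ +-monoʳ-≤ _ (*-monoˡ-≤ 0≤h (+-mono-≤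
                                                 (*-monoˡ-≤ (lipschitz-nonNeg n 0≤B) x+h≤B)
                                                 (^-mono-≤ n 0≤x (≤-trans (x≤x+y 0≤h) x+h≤B)))) ⟩
    x * x ^ n + (B * L + B ^ n) * h         ∎
    where
    L = lipschitz n B
    0≤x+h = +-nonNeg 0≤x 0≤h
    0≤B = ≤-trans 0≤x+h x+h≤B

  -- Take h = D / (L + 1 + D). The summand D in the denominator gives h ≤ 1, and the summand 1 makes
  -- L h < D strict, also for L = 0.
  small-step : ∀ {L D} → 0# ≤ L → 0# < D → ∃[ h ] 0# < h × h ≤ 1# × L * h < D
  small-step {L} {D} 0≤L 0<D = h , 0<h , h≤1 , Lh<D
    where
    E = L + 1# + D
    0<E : 0# < E
    0<E = <-≤-trans 0<D (x≤y+x (+-nonNeg 0≤L 0≤1))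
    h = D * E ⁻¹
    0<h : 0# < h
    0<h = *-pos 0<D (⁻¹-pos 0<E)
    hE≈D : h * E ≈ D
    hE≈D = x*z⁻¹*z≈x D 0<E
    h≤1 : h ≤ 1#
    h≤1 = *-cancelʳ-≤ 0<E $ begin
      h * E   ≈⟨ hE≈D ⟩
      D       ≤⟨ x≤y+x (+-nonNeg 0≤L 0≤1) ⟩
      E       ≈⟨ *-identityˡ E ⟨
      1# * E  ∎
    Lh<D : L * h < D
    Lh<D D≤Lh = +-pos 0<h (*-nonNegative (<⇒≤ 0<D) (<⇒≤ 0<h)) $ +-cancelʳ-≤ (L * h) $ begin
      h + D * h + L * h  ≈⟨ solve 3 (λ l d h → h :+ d :* h :+ l :* h := h :* (l :+ con 1 :+ d)) refl L D h ⟩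
      h * E              ≈⟨ hE≈D ⟩
      D                  ≤⟨ D≤Lh ⟩
      L * h              ≈⟨ +-identityˡ _ ⟨
      0# + L * h         ∎

  module _ (n : ℕ) .{{n≢0 : ℕ.NonZero n}} {x : Carrier} (0≤x : 0# ≤ x) where

    private
      S : Carrier → Set
      S y = 0# ≤ y × y ^ n ≤ x

      s = root n x

      0∈S : S 0#
      0∈S = ≤-refl , ≤-trans (≤-reflexive (0^n≈0 n)) 0≤x

      1≤1+x : 1# ≤ 1# + x
      1≤1+x = x≤x+y 0≤x

      -- The bound is 1 + x and not x, since only a base that is at least 1 satisfies 1 + x ≤ (1 +
      -- x)ⁿ.
      S-bounded : IsUpperBound S (1# + x)
      S-bounded {y} (0≤y , yⁿ≤x) = ^-cancel-≤ n (≤-trans 0≤1 1≤1+x) $ begin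
        y ^ n         ≤⟨ yⁿ≤x ⟩
        x             ≤⟨ x≤y+x 0≤1 ⟩
        1# + x        ≈⟨ *-identityʳ _ ⟨
        (1# + x) ^ 1  ≤⟨ ^-monoʳ-≤ 1≤1+x (ℕ.>-nonZero⁻¹ n) ⟩
        (1# + x) ^ n  ∎

      s-lub = sup-complete S (0# , 0∈S) (1# + x , S-bounded)

    root-nonNeg : 0# ≤ s
    root-nonNeg = proj₁ s-lub 0∈S

    -- Were sⁿ below x, a slightly larger s + h would still lie in `S`; were it above, s - h would
    -- still bound `S`. Either contradicts that s is the least upper bound.
    root-^ : s ^ n ≈ x
    root-^ = antisym (≤-byContradiction x≮sⁿ) (≤-byContradiction sⁿ≮x)
      where
      sⁿ≮x : ¬ (s ^ n < x)
      sⁿ≮x sⁿ<x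
        with d , 0<d , sⁿ+d≈x ← <⇒∃+ sⁿ<x
        -- The Lipschitz constant has to be fixed before h is known; h ≤ 1 keeps s + h in
        -- [0, s + 1].
        with h , 0<h , h≤1 , Lh<d ← small-step (lipschitz-nonNeg n (+-nonNeg root-nonNeg 0≤1)) 0<d
        = 0<h $ +-cancelʳ-≤ s $ begin
          h + s   ≈⟨ +-comm h s ⟩
          s + h   ≤⟨ proj₁ s-lub (+-nonNeg root-nonNeg (<⇒≤ 0<h) , (begin
            (s + h) ^ n                          ≤⟨ ^-lipschitz n root-nonNeg (<⇒≤ 0<h) (+-monoʳ-≤ s h≤1) ⟩
            s ^ n + lipschitz n (s + 1#) * h     ≤⟨ +-monoʳ-≤ _ (<⇒≤ Lh<d) ⟩
            s ^ n + d                            ≈⟨ sⁿ+d≈x ⟩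
            x                                    ∎)) ⟩
          s       ≈⟨ +-identityˡ s ⟨
          0# + s  ∎

      x≮sⁿ : ¬ (x < s ^ n)
      x≮sⁿ x<sⁿ
        with d , 0<d , x+d≈sⁿ ← <⇒∃+ x<sⁿ
        with h , 0<h , h≤1 , Lh<d ← small-step (lipschitz-nonNeg n root-nonNeg) 0<d
        = 0<h $ +-cancelʳ-≤ (s + - h) $ begin
          h + (s + - h)   ≈⟨ +-comm h _ ⟩
          s + - h + h     ≈⟨ x-y+y≈x s h ⟩
          s               ≤⟨ proj₂ s-lub s-h-bound ⟩
          s + - h         ≈⟨ +-identityˡ _ ⟨
          0# + (s + - h)  ∎
        where
        s-h-bound : IsUpperBound S (s + - h)
        s-h-bound {y} y∈S@(0≤y , yⁿ≤x)
          with k , 0≤k , y+k≈s ← ≤⇒∃+ (proj₁ s-lub y∈S)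
          -- A y in `S` above s - h has gap k = s - y ≤ h, so sⁿ ≤ yⁿ + L k ≤ x + L h, against L h <
          -- d = sⁿ - x.
          = ≤-byContradiction λ s-h<y → Lh<d $ +-cancelʳ-≤ x $ begin
            d + x                         ≈⟨ trans (+-comm d x) x+d≈sⁿ ⟩
            s ^ n                         ≈⟨ ^-congˡ n y+k≈s ⟨
            (y + k) ^ n                   ≤⟨ ^-lipschitz n 0≤y 0≤k (≤-reflexive y+k≈s) ⟩
            y ^ n + lipschitz n s * k     ≤⟨ +-mono-≤ yⁿ≤x (*-monoʳ-≤ (lipschitz-nonNeg n root-nonNeg) (k≤h y+k≈s s-h<y)) ⟩
            x + lipschitz n s * h         ≈⟨ +-comm x _ ⟩
            lipschitz n s * h + x         ∎
          where
          k≤h : ∀ {k} → y + k ≈ s → s + - h < y → k ≤ h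
          k≤h {k} y+k≈s s-h<y = +-cancelʳ-≤ y $ begin
            k + y         ≈⟨ trans (+-comm k y) y+k≈s ⟩
            s             ≈⟨ x-y+y≈x s h ⟨
            s + - h + h   ≤⟨ +-monoˡ-≤ h (<⇒≤ s-h<y) ⟩
            y + h         ≈⟨ +-comm y h ⟩
            h + y         ∎

-- Weighted AM-GM and Hölder's inequality with natural weights.

module Inequalities (ℝ : CompleteOrderedField) where
  open OrderedField ℝ
  open Roots ℝ

  2xy≤x²+y² : ∀ x y → x * y + x * y ≤ x * x + y * y
  2xy≤x²+y² x y with total x y
  ... | inj₁ x≤y with d , _ , x+d≈y ← ≤⇒∃+ x≤y = begin
    x * y + x * y                              ≈⟨ +-cong (*-congˡ x+d≈y) (*-congˡ x+d≈y) ⟨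
    x * (x + d) + x * (x + d)                  ≤⟨ x≤x+y (square-nonNeg d) ⟩
    x * (x + d) + x * (x + d) + d * d          ≈⟨ solve 2 (λ x d → x :* (x :+ d) :+ x :* (x :+ d) :+ d :* d := x :* x :+ (x :+ d) :* (x :+ d)) refl x d ⟩
    x * x + (x + d) * (x + d)                  ≈⟨ +-congˡ (*-cong x+d≈y x+d≈y) ⟩
    x * x + y * y                              ∎
  ... | inj₂ y≤x with d , _ , y+d≈x ← ≤⇒∃+ y≤x = begin
    x * y + x * y                              ≈⟨ +-cong (*-congʳ y+d≈x) (*-congʳ y+d≈x) ⟨
    (y + d) * y + (y + d) * y                  ≤⟨ x≤x+y (square-nonNeg d) ⟩
    (y + d) * y + (y + d) * y + d * d          ≈⟨ solve 2 (λ y d → (y :+ d) :* y :+ (y :+ d) :* y :+ d :* d := (y :+ d) :* (y :+ d) :+ y :* y) refl y d ⟩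
    (y + d) * (y + d) + y * y                  ≈⟨ +-congʳ (*-cong y+d≈x y+d≈x) ⟩
    x * x + y * y                              ∎

  -- Bernoulli's inequality made homogeneous, or AM-GM with weights n and 1. The induction step adds
  -- (n + 1) xⁿ times 2xy ≤ x² + y² to y times the induction hypothesis; the term added on both
  -- sides and cancelled is the part that this sum has in excess.
  bernoulli : ∀ n {x y} → 0# ≤ x → 0# ≤ y →
              fromℕ (suc n) * (x ^ n * y) ≤ fromℕ n * x ^ suc n + y ^ suc n
  bernoulli zero {x} {y} 0≤x 0≤y = ≤-reflexive $
    solve 2 (λ x y → (con 1 :+ con 0) :* (con 1 :* y) := con 0 :* (x :* con 1) :+ y :* con 1) refl x y
  bernoulli (suc n) {x} {y} 0≤x 0≤y = +-cancelʳ-≤ (N * p * (y * y) + K * (x * p * y)) $ begin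
    (1# + N) * (x * p * y) + (N * p * (y * y) + K * (x * p * y))
      ≈⟨ solve 4 (λ k x y p →
           (con 1 :+ (con 1 :+ k)) :* (x :* p :* y) :+ ((con 1 :+ k) :* p :* (y :* y) :+ k :* (x :* p :* y)) :=
           (con 1 :+ k) :* p :* (x :* y :+ x :* y) :+ y :* ((con 1 :+ k) :* (p :* y)))
           refl K x y p ⟩
    N * p * (x * y + x * y) + y * (N * (p * y))
      ≤⟨ +-mono-≤ (*-monoʳ-≤ (*-nonNegative (fromℕ-nonNeg (suc n)) (^-nonNeg n 0≤x)) (2xy≤x²+y² x y))
                  (*-monoʳ-≤ 0≤y (bernoulli n 0≤x 0≤y)) ⟩
    N * p * (x * x + y * y) + y * (K * (x * p) + y ^ suc n)
      ≈⟨ solve 5 (λ k x y p r →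
           (con 1 :+ k) :* p :* (x :* x :+ y :* y) :+ y :* (k :* (x :* p) :+ r) :=
           (con 1 :+ k) :* (x :* (x :* p)) :+ y :* r :+ ((con 1 :+ k) :* p :* (y :* y) :+ k :* (x :* p :* y)))
           refl K x y p (y ^ suc n) ⟩
    N * x ^ suc (suc n) + y ^ suc (suc n) + (N * p * (y * y) + K * (x * p * y)) ∎
    where
    K = fromℕ n
    N = fromℕ (suc n)
    p = x ^ n

  -- AM-GM with weights p and q, by induction on q. Multiplying the hypothesis by y leaves one mixed
  -- term, x to the power q + p times y, which `bernoulli` splits into pure powers. The factor N,
  -- positive since p is, lets the hypothesis be used without division.
  young : ∀ p q .{{_ : ℕ.NonZero p}} {x y} → 0# ≤ x → 0# ≤ y →
          fromℕ (q ℕ.+ p) * (x ^ p * y ^ q) ≤ fromℕ p * x ^ (q ℕ.+ p) + fromℕ q * y ^ (q ℕ.+ p)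
  young p zero {x} {y} 0≤x 0≤y = ≤-reflexive $
    solve 3 (λ k x y → k :* (x :* con 1) := k :* x :+ con 0 :* y) refl (fromℕ p) (x ^ p) (y ^ p)
  young p (suc q) {x} {y} 0≤x 0≤y = *-cancelˡ-≤ 0<N $ begin
    N * ((1# + N) * (x ^ p * (y * y ^ q)))
      ≈⟨ solve 4 (λ k a y b → k :* ((con 1 :+ k) :* (a :* (y :* b))) := (con 1 :+ k) :* y :* (k :* (a :* b)))
           refl N (x ^ p) y (y ^ q) ⟩
    (1# + N) * y * (N * (x ^ p * y ^ q))
      ≤⟨ *-monoʳ-≤ (*-nonNegative (fromℕ-nonNeg (suc n)) 0≤y) (young p q 0≤x 0≤y) ⟩
    (1# + N) * y * (P * x ^ n + Q * y ^ n)
      ≈⟨ solve 6 (λ k p q y a b →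
           (con 1 :+ k) :* y :* (p :* a :+ q :* b) := p :* ((con 1 :+ k) :* (a :* y)) :+ (con 1 :+ k) :* q :* (y :* b))
           refl N P Q y (x ^ n) (y ^ n) ⟩
    P * ((1# + N) * (x ^ n * y)) + (1# + N) * Q * y ^ suc n
      ≤⟨ +-monoˡ-≤ _ (*-monoʳ-≤ (fromℕ-nonNeg p) (bernoulli n 0≤x 0≤y)) ⟩
    P * (N * x ^ suc n + y ^ suc n) + (1# + N) * Q * y ^ suc n
      ≈⟨ solve 5 (λ k p q a b →
           p :* (k :* a :+ b) :+ (con 1 :+ k) :* q :* b := k :* (p :* a) :+ ((q :+ p) :+ k :* q) :* b)
           refl N P Q (x ^ suc n) (y ^ suc n) ⟩
    N * (P * x ^ suc n) + ((Q + P) + N * Q) * y ^ suc n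
      ≈⟨ +-congˡ (*-congʳ (+-congʳ (fromℕ-+ q p))) ⟨
    N * (P * x ^ suc n) + (N + N * Q) * y ^ suc n
      ≈⟨ solve 5 (λ k p q a b →
           k :* (p :* a) :+ (k :+ k :* q) :* b := k :* (p :* a :+ (con 1 :+ q) :* b))
           refl N P Q (x ^ suc n) (y ^ suc n) ⟩
    N * (P * x ^ suc n + (1# + Q) * y ^ suc n) ∎
    where
    n = q ℕ.+ p
    N = fromℕ n
    P = fromℕ p
    Q = fromℕ q
    0<N : 0# < N
    0<N = fromℕ-pos n {{ℕ.>-nonZero (ℕ.≤-trans (ℕ.>-nonZero⁻¹ p) (ℕ.m≤n+m p q))}}

  -- This is Hölder for the conjugate exponents N/p and N/q, N = q + p, applied to aᵖ and b^q. The
  -- roots α and β of the two sums are passed in with their defining equations.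
  hölder : ∀ p q .{{_ : ℕ.NonZero p}} {n} {a b : Vector Carrier n} {α β} →
           (∀ i → 0# ≤ a i) → (∀ i → 0# ≤ b i) → 0# ≤ α → 0# ≤ β →
           (sum λ i → a i ^ (q ℕ.+ p)) ≈ α ^ (q ℕ.+ p) →
           (sum λ i → b i ^ (q ℕ.+ p)) ≈ β ^ (q ℕ.+ p) →
           (sum λ i → a i ^ p * b i ^ q) ≤ α ^ p * β ^ q
  -- For q = 0 the factor β ^ q is 1 even when β vanishes, so the degenerate case below would fail.
  hölder p zero {a = a} {b} {α} {β} 0≤a 0≤b 0≤α 0≤β Σaᴺ≈αᴺ Σbᴺ≈βᴺ = begin
    (sum λ i → a i ^ p * 1#)  ≈⟨ *-distribʳ-sum 1# (λ i → a i ^ p) ⟨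
    (sum λ i → a i ^ p) * 1#  ≈⟨ *-congʳ Σaᴺ≈αᴺ ⟩
    α ^ p * 1#                ∎
  hölder p q@(suc _) {n} {a} {b} {α} {β} 0≤a 0≤b 0≤α 0≤β Σaᴺ≈αᴺ Σbᴺ≈βᴺ with α ≟ 0# | β ≟ 0#
  -- The general case cancels powers of α and β. A vanishing α forces every `a i` to vanish, because
  -- one N-th power is at most the sum of all; likewise for β.
  ... | yes α≈0 | _ = begin
    (sum λ i → a i ^ p * b i ^ q)  ≤⟨ sum-mono-≤ (λ i → *-monoˡ-≤ (^-nonNeg q (0≤b i)) (^-mono-≤ p (0≤a i) (a≤α i))) ⟩
    (sum λ i → α ^ p * b i ^ q)    ≈⟨ *-distribˡ-sum (α ^ p) (λ i → b i ^ q) ⟨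
    α ^ p * (sum λ i → b i ^ q)    ≈⟨ *-congʳ αᵖ≈0 ⟩
    0# * (sum λ i → b i ^ q)       ≈⟨ trans (zeroˡ _) (sym (zeroˡ _)) ⟩
    0# * β ^ q                     ≈⟨ *-congʳ αᵖ≈0 ⟨
    α ^ p * β ^ q                  ∎
    where
    αᵖ≈0 = trans (^-congˡ p α≈0) (0^n≈0 p)
    a≤α : ∀ i → a i ≤ α
    a≤α i = ^-cancel-≤ (q ℕ.+ p) 0≤α
      (≤-trans (term≤sum (λ j → ^-nonNeg (q ℕ.+ p) (0≤a j)) i) (≤-reflexive Σaᴺ≈αᴺ))
  ... | no _ | yes β≈0 = begin
    (sum λ i → a i ^ p * b i ^ q)  ≤⟨ sum-mono-≤ (λ i → *-monoʳ-≤ (^-nonNeg p (0≤a i)) (^-mono-≤ q (0≤b i) (b≤β i))) ⟩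
    (sum λ i → a i ^ p * β ^ q)    ≈⟨ *-distribʳ-sum (β ^ q) (λ i → a i ^ p) ⟨
    (sum λ i → a i ^ p) * β ^ q    ≈⟨ *-congˡ β^q≈0 ⟩
    (sum λ i → a i ^ p) * 0#       ≈⟨ trans (zeroʳ _) (sym (zeroʳ _)) ⟩
    α ^ p * 0#                     ≈⟨ *-congˡ β^q≈0 ⟨
    α ^ p * β ^ q                  ∎
    where
    β^q≈0 = trans (^-congˡ q β≈0) (0^n≈0 q)
    b≤β : ∀ i → b i ≤ β
    b≤β i = ^-cancel-≤ (q ℕ.+ p) 0≤β
      (≤-trans (term≤sum (λ j → ^-nonNeg (q ℕ.+ p) (0≤b j)) i) (≤-reflexive Σbᴺ≈βᴺ))
  -- Young's inequality for aᵢβ and bᵢα, which avoids normalising a and b by division.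
  ... | no α≉0 | no β≉0 = *-cancelˡ-≤ (*-pos 0<N 0<c) $ begin
    N * c * (sum λ i → a i ^ p * b i ^ q)
      ≈⟨ *-distribˡ-sum (N * c) (λ i → a i ^ p * b i ^ q) ⟩
    (sum λ i → N * c * (a i ^ p * b i ^ q))
      ≤⟨ sum-mono-≤ term ⟩
    (sum λ i → P * β ^ m * a i ^ m + Q * α ^ m * b i ^ m)
      ≈⟨ ∑-distrib-+ (λ i → P * β ^ m * a i ^ m) (λ i → Q * α ^ m * b i ^ m) ⟩
    (sum λ i → P * β ^ m * a i ^ m) + (sum λ i → Q * α ^ m * b i ^ m)
      ≈⟨ +-cong (*-distribˡ-sum (P * β ^ m) (λ i → a i ^ m)) (*-distribˡ-sum (Q * α ^ m) (λ i → b i ^ m)) ⟨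
    P * β ^ m * (sum λ i → a i ^ m) + Q * α ^ m * (sum λ i → b i ^ m)
      ≈⟨ +-cong (*-congˡ Σaᴺ≈αᴺ) (*-congˡ Σbᴺ≈βᴺ) ⟩
    P * β ^ m * α ^ m + Q * α ^ m * β ^ m
      ≈⟨ solve 4 (λ p q a b → p :* b :* a :+ q :* a :* b := (q :+ p) :* (a :* b)) refl P Q (α ^ m) (β ^ m) ⟩
    (Q + P) * (α ^ m * β ^ m)
      ≈⟨ *-cong (sym (fromℕ-+ q p)) (*-cong (^-homo-* α q p) (^-homo-* β q p)) ⟩
    N * ((α ^ q * α ^ p) * (β ^ q * β ^ p))
      ≈⟨ solve 5 (λ n a b c d → n :* ((a :* b) :* (c :* d)) := n :* (d :* a) :* (b :* c))
           refl N (α ^ q) (α ^ p) (β ^ q) (β ^ p) ⟩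
    N * c * (α ^ p * β ^ q) ∎
    where
    m = q ℕ.+ p
    N = fromℕ m
    P = fromℕ p
    Q = fromℕ q
    c = β ^ p * α ^ q
    0<N : 0# < N
    0<N = fromℕ-pos m
    0<c : 0# < c
    0<c = *-pos (^-pos p (0≤∧≉0⇒0< 0≤β β≉0)) (^-pos q (0≤∧≉0⇒0< 0≤α α≉0))
    term : ∀ i → N * c * (a i ^ p * b i ^ q) ≤ P * β ^ m * a i ^ m + Q * α ^ m * b i ^ m
    term i = begin
      N * c * (a i ^ p * b i ^ q)
        ≈⟨ solve 5 (λ n b a x y → n :* (b :* a) :* (x :* y) := n :* ((x :* b) :* (y :* a)))
             refl N (β ^ p) (α ^ q) (a i ^ p) (b i ^ q) ⟩
      N * ((a i ^ p * β ^ p) * (b i ^ q * α ^ q))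
        ≈⟨ *-congˡ (*-cong (^-distrib-* (a i) β p) (^-distrib-* (b i) α q)) ⟨
      N * ((a i * β) ^ p * (b i * α) ^ q)
        ≤⟨ young p q (*-nonNegative (0≤a i) 0≤β) (*-nonNegative (0≤b i) 0≤α) ⟩
      P * (a i * β) ^ m + Q * (b i * α) ^ m
        ≈⟨ +-cong (*-congˡ (^-distrib-* (a i) β m)) (*-congˡ (^-distrib-* (b i) α m)) ⟩
      P * (a i ^ m * β ^ m) + Q * (b i ^ m * α ^ m)
        ≈⟨ solve 6 (λ p q x b y a → p :* (x :* b) :+ q :* (y :* a) := p :* b :* x :+ q :* a :* y)
             refl P Q (a i ^ m) (β ^ m) (b i ^ m) (α ^ m) ⟩
      P * β ^ m * a i ^ m + Q * α ^ m * b i ^ m ∎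

-- Norms with rational exponents and the operator norm.

module Norms (ℝ : CompleteOrderedField) where
  open OrderedField ℝ
  open Roots ℝ

  -- Unnormalised fractions keep numerator and denominator as written, so once `b` is a successor
  -- the power a/b unfolds to the b-th root of xᵃ. The same matching serves the next three lemmas.
  ^ℚ-nonNeg : ∀ a b .{{_ : ℕ.NonZero b}} {x} → 0# ≤ x → 0# ≤ x ^ℚ ((+ a) ℚ./ b)
  ^ℚ-nonNeg a (suc b) 0≤x = root-nonNeg (suc b) (^-nonNeg a 0≤x)

  ^ℚ-^ : ∀ a b .{{_ : ℕ.NonZero b}} {x} → 0# ≤ x → (x ^ℚ ((+ a) ℚ./ b)) ^ b ≈ x ^ a
  ^ℚ-^ a (suc b) 0≤x = root-^ (suc b) (^-nonNeg a 0≤x)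

  ^ℚ-1/-nonNeg : ∀ a b .{{_ : ℕ.NonZero a}} .{{_ : ℕ.NonZero b}} .{{_ : ℚ.NonZero ((+ a) ℚ./ b)}} {x} →
                 0# ≤ x → 0# ≤ x ^ℚ (ℚ.1/ ((+ a) ℚ./ b))
  ^ℚ-1/-nonNeg (suc a) (suc b) 0≤x = root-nonNeg (suc a) (^-nonNeg (suc b) 0≤x)

  ^ℚ-1/-^ : ∀ a b .{{_ : ℕ.NonZero a}} .{{_ : ℕ.NonZero b}} .{{_ : ℚ.NonZero ((+ a) ℚ./ b)}} {x} →
            0# ≤ x → (x ^ℚ (ℚ.1/ ((+ a) ℚ./ b))) ^ a ≈ x ^ b
  ^ℚ-1/-^ (suc a) (suc b) 0≤x = root-^ (suc a) (^-nonNeg (suc b) 0≤x)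

  module _ (a b : ℕ) .{{a≢0 : ℕ.NonZero a}} .{{b≢0 : ℕ.NonZero b}} .{{q≢0 : ℚ.NonZero ((+ a) ℚ./ b)}} where

    private
      q = (+ a) ℚ./ b

      powers-nonNeg : ∀ {n} (x : Vector Carrier n) i → 0# ≤ ∣ x i ∣ ^ℚ q
      powers-nonNeg x i = ^ℚ-nonNeg a b (∣x∣-nonNeg (x i))

    norm-nonNeg : ∀ {n} (x : Vector Carrier n) → 0# ≤ norm q x
    norm-nonNeg x = ^ℚ-1/-nonNeg a b (sum-nonNeg (powers-nonNeg x))

    norm-^ : ∀ {n} (x : Vector Carrier n) → norm q x ^ a ≈ (sum λ i → ∣ x i ∣ ^ℚ q) ^ b
    norm-^ x = ^ℚ-1/-^ a b (sum-nonNeg (powers-nonNeg x))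

    ∣x∣≤norm : ∀ {n} (x : Vector Carrier n) i → ∣ x i ∣ ≤ norm q x
    ∣x∣≤norm x i = ^-cancel-≤ a (norm-nonNeg x) $ begin
      ∣ x i ∣ ^ a                       ≈⟨ ^ℚ-^ a b (∣x∣-nonNeg (x i)) ⟨
      (∣ x i ∣ ^ℚ q) ^ b                ≤⟨ ^-mono-≤ b (powers-nonNeg x i) (term≤sum (powers-nonNeg x) i) ⟩
      (sum λ j → ∣ x j ∣ ^ℚ q) ^ b      ≈⟨ norm-^ x ⟨
      norm q x ^ a                      ∎

    norm-pos : ∀ {n} {x : Vector Carrier n} → ¬ (∀ i → x i ≈ 0#) → 0# < norm q x
    norm-pos {x = x} x≉0 norm≤0 = x≉0 λ i →
      ∣x∣≈0⇒x≈0 (antisym (≤-trans (∣x∣≤norm x i) norm≤0) (∣x∣-nonNeg (x i)))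

    -- The natural constant is n to the power b/a; b ≤ a allows replacing it by n, which is enough
    -- for boundedness.
    norm≤ : b ℕ.≤ a → ∀ {n} .{{_ : ℕ.NonZero n}} {x : Vector Carrier n} {c} →
            0# ≤ c → (∀ i → ∣ x i ∣ ≤ c) → norm q x ≤ fromℕ n * c
    norm≤ b≤a {n} {x} {c} 0≤c ∣x∣≤c =
      ^-cancel-≤ a (*-nonNegative (fromℕ-nonNeg n) 0≤c) $ begin
        norm q x ^ a                      ≈⟨ norm-^ x ⟩
        (sum λ i → ∣ x i ∣ ^ℚ q) ^ b      ≤⟨ ^-mono-≤ b (sum-nonNeg (powers-nonNeg x)) (sum-mono-≤ power≤) ⟩
        (sum {n} λ _ → r) ^ b             ≈⟨ ^-congˡ b (sum-const n r) ⟩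
        (fromℕ n * r) ^ b                 ≈⟨ ^-distrib-* (fromℕ n) r b ⟩
        fromℕ n ^ b * r ^ b               ≈⟨ *-congˡ (root-^ b 0≤cᵃ) ⟩
        fromℕ n ^ b * c ^ a               ≤⟨ *-monoˡ-≤ 0≤cᵃ (^-monoʳ-≤ (1≤fromℕ n) b≤a) ⟩
        fromℕ n ^ a * c ^ a               ≈⟨ ^-distrib-* (fromℕ n) c a ⟨
        (fromℕ n * c) ^ a                 ∎
      where
      0≤cᵃ = ^-nonNeg a 0≤c
      r = root b (c ^ a)
      power≤ : ∀ i → ∣ x i ∣ ^ℚ q ≤ r
      power≤ i = ^-cancel-≤ b (root-nonNeg b 0≤cᵃ) $ begin
        (∣ x i ∣ ^ℚ q) ^ b  ≈⟨ ^ℚ-^ a b (∣x∣-nonNeg (x i)) ⟩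
        ∣ x i ∣ ^ a         ≤⟨ ^-mono-≤ a (∣x∣-nonNeg (x i)) (∣x∣≤c i) ⟩
        c ^ a               ≈⟨ root-^ b 0≤cᵃ ⟨
        r ^ b               ∎

    -- For a vector given as b-th powers of `y`, the power a/b of an entry is just yᵃ, and the norm
    -- is described without roots.
    norm-^-power : ∀ {n} {x y : Vector Carrier n} → (∀ i → 0# ≤ y i) → (∀ i → x i ≈ y i ^ b) →
                   norm q x ^ a ≈ (sum λ i → y i ^ a) ^ b
    norm-^-power {x = x} {y} 0≤y x≈yᵇ =
      trans (norm-^ x) (^-congˡ b (sum-cong-≋ λ i →
        ^-injective b (powers-nonNeg x i) (^-nonNeg a (0≤y i)) $ begin-equality
          (∣ x i ∣ ^ℚ q) ^ b  ≈⟨ ^ℚ-^ a b (∣x∣-nonNeg (x i)) ⟩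
          ∣ x i ∣ ^ a         ≈⟨ ^-congˡ a (0≤x⇒∣x∣≈x (0≤x i)) ⟩
          x i ^ a             ≈⟨ ^-congˡ a (x≈yᵇ i) ⟩
          (y i ^ b) ^ a       ≈⟨ ^-^-comm (y i) b a ⟩
          (y i ^ a) ^ b       ∎))
      where
      0≤x : ∀ i → 0# ≤ x i
      0≤x i = ≤-trans (^-nonNeg b (0≤y i)) (≤-reflexive (sym (x≈yᵇ i)))

  ∣*ᵥ∣≤ : ∀ {n} {A : Matrix n} → (∀ i j → 0# ≤ A i j) → ∀ x i →
          ∣ (A *ᵥ x) i ∣ ≤ (A *ᵥ (∣_∣ ∘ x)) i
  ∣*ᵥ∣≤ {A = A} 0≤A x i = ∣x∣≤
    (sum-mono-≤ λ j → *-monoʳ-≤ (0≤A i j) (x≤∣x∣ (x j)))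
    -- The bound on -s amounts to nonnegativity of A applied to ∣x∣ + x.
    (+-cancelʳ-≤ s $ begin
      - s + s                                   ≈⟨ -‿inverseˡ s ⟩
      0#                                        ≤⟨ sum-nonNeg (λ j → *-nonNegative (0≤A i j) (0≤∣x∣+x (x j))) ⟩
      (sum λ j → A i j * (∣ x j ∣ + x j))       ≈⟨ sum-cong-≋ (λ j → distribˡ (A i j) ∣ x j ∣ (x j)) ⟩
      (sum λ j → A i j * ∣ x j ∣ + A i j * x j) ≈⟨ ∑-distrib-+ (λ j → A i j * ∣ x j ∣) (λ j → A i j * x j) ⟩
      (A *ᵥ (∣_∣ ∘ x)) i + s                    ∎)
    where
    s = (A *ᵥ x) i
    0≤∣x∣+x : ∀ x → 0# ≤ ∣ x ∣ + x
    0≤∣x∣+x x = begin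
      0#         ≈⟨ -‿inverseˡ x ⟨
      - x + x    ≤⟨ +-monoˡ-≤ x (-x≤∣x∣ x) ⟩
      ∣ x ∣ + x  ∎

  module _ (N m v : ℕ) .{{N≢0 : ℕ.NonZero N}} .{{m≢0 : ℕ.NonZero m}} .{{v≢0 : ℕ.NonZero v}}
           .{{p≢0 : ℚ.NonZero ((+ N) ℚ./ m)}} .{{r≢0 : ℚ.NonZero ((+ N) ℚ./ v)}} (v≤N : v ℕ.≤ N) where

    private
      p = (+ N) ℚ./ m
      r = (+ N) ℚ./ v

    -- The supremum dominates each quotient once the quotients are bounded. With entries in [0, 1],
    -- each coordinate of A x is at most n ‖x‖_p, and `norm≤` costs another factor n; hence the
    -- bound n².
    norm-*ᵥ≤opNorm : ∀ {n} .{{_ : ℕ.NonZero n}} {A : Matrix n} →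
                     (∀ i j → 0# ≤ A i j) → (∀ i j → A i j ≤ 1#) →
                     ∀ {x} → ¬ (∀ i → x i ≈ 0#) → norm r (A *ᵥ x) ≤ opNorm p r A * norm p x
    norm-*ᵥ≤opNorm {n} {A} 0≤A A≤1 {x} x≉0 = begin
      norm r (A *ᵥ x)                            ≈⟨ x*z⁻¹*z≈x _ (norm-pos N m x≉0) ⟨
      norm r (A *ᵥ x) / norm p x * norm p x      ≤⟨ *-monoˡ-≤ (norm-nonNeg N m x)
                                                      (proj₁ (sup-complete _ (_ , x , x≉0 , refl) (C , bound)) (x , x≉0 , refl)) ⟩
      opNorm p r A * norm p x                    ∎
      where
      C = fromℕ n * fromℕ n
      entry≤ : ∀ x i → ∣ (A *ᵥ x) i ∣ ≤ fromℕ n * norm p x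
      entry≤ x i = begin
        ∣ (A *ᵥ x) i ∣                    ≤⟨ ∣*ᵥ∣≤ 0≤A x i ⟩
        (sum λ j → A i j * ∣ x j ∣)       ≤⟨ sum-mono-≤ (λ j → *-mono-≤ (∣x∣-nonNeg (x j)) 0≤1 (A≤1 i j) (∣x∣≤norm N m x j)) ⟩
        (sum {n} λ _ → 1# * norm p x)     ≈⟨ sum-const n _ ⟩
        fromℕ n * (1# * norm p x)         ≈⟨ *-congˡ (*-identityˡ _) ⟩
        fromℕ n * norm p x                ∎
      bound : IsUpperBound (λ t → ∃[ x ] ¬ (∀ i → x i ≈ 0#) × t ≈ norm r (A *ᵥ x) / norm p x) C
      bound {t} (x , x≉0 , t≈) = *-cancelʳ-≤ (norm-pos N m x≉0) $ begin
        t * norm p x                           ≈⟨ *-congʳ t≈ ⟩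
        norm r (A *ᵥ x) / norm p x * norm p x  ≈⟨ x*z⁻¹*z≈x _ (norm-pos N m x≉0) ⟩
        norm r (A *ᵥ x)                        ≤⟨ norm≤ N v v≤N (*-nonNegative (fromℕ-nonNeg n) (norm-nonNeg N m x)) (entry≤ x) ⟩
        fromℕ n * (fromℕ n * norm p x)         ≈⟨ *-assoc _ _ _ ⟨
        C * norm p x                           ∎

-- From the operator norm to the spectral radius of a symmetric 0-1 matrix.

module Spectral (ℝ : CompleteOrderedField) where
  open OrderedField ℝ
  open Roots ℝ
  open Inequalities ℝ
  open Norms ℝ

  -- The exponents N/v and N/m are conjugate because m + v = N. Writing z as v-th powers and x as
  -- m-th powers of roots brings the pairing into the shape of `hölder`.
  hölder-norm : ∀ m v {N} .{{_ : ℕ.NonZero N}} .{{_ : ℕ.NonZero m}} .{{_ : ℕ.NonZero v}}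
                .{{_ : ℚ.NonZero ((+ N) ℚ./ m)}} .{{_ : ℚ.NonZero ((+ N) ℚ./ v)}} →
                m ℕ.+ v ≡ N → ∀ {n} {z x : Vector Carrier n} → (∀ i → 0# ≤ z i) → (∀ i → 0# ≤ x i) →
                (sum λ i → z i * x i) ≤ norm ((+ N) ℚ./ v) z * norm ((+ N) ℚ./ m) x
  hölder-norm m v {N} ≡.refl {n} {z} {x} 0≤z 0≤x = begin
    (sum λ i → z i * x i)          ≈⟨ sum-cong-≋ (λ i → *-cong (root-^ v (0≤z i)) (root-^ m (0≤x i))) ⟨
    (sum λ i → y i ^ v * w i ^ m)  ≤⟨ hölder v m (λ i → root-nonNeg v (0≤z i)) (λ i → root-nonNeg m (0≤x i))
                                        (root-nonNeg N (0≤Σ v 0≤z)) (root-nonNeg N (0≤Σ m 0≤x))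
                                        (sym (root-^ N (0≤Σ v 0≤z))) (sym (root-^ N (0≤Σ m 0≤x))) ⟩
    root N (Σroots v z) ^ v * root N (Σroots m x) ^ m ≈⟨ *-cong (root≈norm v 0≤z) (root≈norm m 0≤x) ⟩
    norm ((+ N) ℚ./ v) z * norm ((+ N) ℚ./ m) x ∎
    where
    y = λ i → root v (z i)
    w = λ i → root m (x i)
    Σroots : ℕ → Vector Carrier n → Carrier
    Σroots b x = sum λ i → root b (x i) ^ N
    0≤Σ : ∀ b .{{_ : ℕ.NonZero b}} {x} → (∀ i → 0# ≤ x i) → 0# ≤ Σroots b x
    0≤Σ b 0≤x = sum-nonNeg λ i → ^-nonNeg N (root-nonNeg b (0≤x i))
    root≈norm : ∀ b .{{_ : ℕ.NonZero b}} .{{_ : ℚ.NonZero ((+ N) ℚ./ b)}} {x} →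
                (∀ i → 0# ≤ x i) → root N (Σroots b x) ^ b ≈ norm ((+ N) ℚ./ b) x
    -- Two nonnegative numbers with the same N-th power are equal.
    root≈norm b {x} 0≤x = ^-injective N (^-nonNeg b (root-nonNeg N (0≤Σ b 0≤x))) (norm-nonNeg N b x) $ begin-equality
      (root N (Σroots b x) ^ b) ^ N ≈⟨ ^-^-comm _ b N ⟩
      (root N (Σroots b x) ^ N) ^ b ≈⟨ ^-congˡ b (root-^ N (0≤Σ b 0≤x)) ⟩
      Σroots b x ^ b                ≈⟨ norm-^-power N b (λ i → root-nonNeg b (0≤x i)) (λ i → sym (root-^ b (0≤x i))) ⟨
      norm ((+ N) ℚ./ b) x ^ N      ∎

  -- Hölder's inequality for each row, and then for the vector of row sums.
  hölder₂ : ∀ p q .{{_ : ℕ.NonZero p}} {k l} {a b : Fin k → Fin l → Carrier} →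
            (∀ i j → 0# ≤ a i j) → (∀ i j → 0# ≤ b i j) →
            (sum λ i → sum λ j → a i j ^ p * b i j ^ q) ^ (q ℕ.+ p) ≤
            (sum λ i → sum λ j → a i j ^ (q ℕ.+ p)) ^ p * (sum λ i → sum λ j → b i j ^ (q ℕ.+ p)) ^ q
  hölder₂ p@(suc p-1) q {k} {l} {a} {b} 0≤a 0≤b = begin
    (sum λ i → sum λ j → a i j ^ p * b i j ^ q) ^ N
      ≤⟨ ^-mono-≤ N (sum-nonNeg λ i → sum-nonNeg λ j → *-nonNegative (^-nonNeg p (0≤a i j)) (^-nonNeg q (0≤b i j))) (≤-trans
           (sum-mono-≤ λ i → hölder p q (0≤a i) (0≤b i) (root-nonNeg N (0≤row 0≤a i)) (root-nonNeg N (0≤row 0≤b i))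
             (sym (root-^ N (0≤row 0≤a i))) (sym (root-^ N (0≤row 0≤b i))))
           (hölder p q (λ i → root-nonNeg N (0≤row 0≤a i)) (λ i → root-nonNeg N (0≤row 0≤b i))
             (root-nonNeg N (0≤total 0≤a)) (root-nonNeg N (0≤total 0≤b)) (rows≈total 0≤a) (rows≈total 0≤b))) ⟩
    (root N (grandTotal a) ^ p * root N (grandTotal b) ^ q) ^ N
      ≈⟨ ^-distrib-* _ _ N ⟩
    (root N (grandTotal a) ^ p) ^ N * (root N (grandTotal b) ^ q) ^ N
      ≈⟨ *-cong (^-^-comm _ p N) (^-^-comm _ q N) ⟩
    (root N (grandTotal a) ^ N) ^ p * (root N (grandTotal b) ^ N) ^ q
      ≈⟨ *-cong (^-congˡ p (root-^ N (0≤total 0≤a))) (^-congˡ q (root-^ N (0≤total 0≤b))) ⟩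
    grandTotal a ^ p * grandTotal b ^ q ∎
    where
    N = q ℕ.+ p
    instance
      N≢0 : ℕ.NonZero N
      N≢0 = ℕ.>-nonZero (ℕ.m≤n⇒m≤o+n q (ℕ.s≤s ℕ.z≤n))
    row : (Fin k → Fin l → Carrier) → Fin k → Carrier
    row c i = sum λ j → c i j ^ N
    grandTotal : (Fin k → Fin l → Carrier) → Carrier
    grandTotal c = sum (row c)
    0≤row : ∀ {c} → (∀ i j → 0# ≤ c i j) → ∀ i → 0# ≤ row c i
    0≤row 0≤c i = sum-nonNeg λ j → ^-nonNeg N (0≤c i j)
    0≤total : ∀ {c} → (∀ i j → 0# ≤ c i j) → 0# ≤ grandTotal c
    0≤total 0≤c = sum-nonNeg (0≤row 0≤c)
    rows≈total : ∀ {c} → (∀ i j → 0# ≤ c i j) → (sum λ i → root N (row c i) ^ N) ≈ root N (grandTotal c) ^ N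
    rows≈total 0≤c = trans (sum-cong-≋ λ i → root-^ N (0≤row 0≤c i)) (sym (root-^ N (0≤total 0≤c)))

  quadraticForm : ∀ {n} → Matrix n → Vector Carrier n → Carrier
  quadraticForm A x = sum λ i → (A *ᵥ x) i * x i

  quadraticForm-double : ∀ {n} (A : Matrix n) x → quadraticForm A x ≈ (sum λ i → sum λ j → A i j * (x j * x i))
  quadraticForm-double A x = sum-cong-≋ λ i → trans (*-distribʳ-sum (x i) (λ j → A i j * x j))
    (sum-cong-≋ λ j → *-assoc (A i j) (x j) (x i))

  *ᵥ-selfAdjoint : ∀ {n} {A : Matrix n} → (∀ i j → A i j ≈ A j i) → ∀ x y →
                   (sum λ i → (A *ᵥ x) i * y i) ≈ (sum λ i → (A *ᵥ y) i * x i)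
  *ᵥ-selfAdjoint {A = A} A-sym x y = begin-equality
    (sum λ i → (A *ᵥ x) i * y i)            ≈⟨ sum-cong-≋ (λ i → *-distribʳ-sum (y i) (λ j → A i j * x j)) ⟩
    (sum λ i → sum λ j → A i j * x j * y i) ≈⟨ ∑-comm (λ i j → A i j * x j * y i) ⟩
    (sum λ j → sum λ i → A i j * x j * y i) ≈⟨ sum-cong-≋ (λ j → sum-cong-≋ λ i → trans (*-congʳ (*-congʳ (A-sym i j)))
                                                 (solve 3 (λ a x y → a :* x :* y := a :* y :* x) refl (A j i) (x j) (y i))) ⟩
    (sum λ j → sum λ i → A j i * y i * x j) ≈⟨ sum-cong-≋ (λ j → *-distribʳ-sum (x j) (λ i → A j i * y i)) ⟨
    (sum λ j → (A *ᵥ y) j * x j)            ∎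

  ∑x²-pos : ∀ {n} {x : Vector Carrier n} → ¬ (∀ i → x i ≈ 0#) → 0# < (sum λ i → x i * x i)
  ∑x²-pos {x = x} x≉0 Σ≤0 = x≉0 λ i → ∣x∣≈0⇒x≈0 $ ^-cancel-≈0 2 (∣x∣-nonNeg (x i)) $ begin-equality
    ∣ x i ∣ * (∣ x i ∣ * 1#) ≈⟨ *-congˡ (*-identityʳ _) ⟩
    ∣ x i ∣ * ∣ x i ∣        ≈⟨ ∣x∣*∣x∣≈x*x (x i) ⟩
    x i * x i                ≈⟨ antisym (≤-trans (term≤sum (λ j → square-nonNeg (x j)) i) Σ≤0) (square-nonNeg (x i)) ⟩
    0#                       ∎

  module ZeroOneMatrix {n} .{{n≢0 : ℕ.NonZero n}} {A : Matrix n}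
                       (A-01 : ∀ i j → A i j ≈ 0# ⊎ A i j ≈ 1#) (A-sym : ∀ i j → A i j ≈ A j i) where

    0≤A : ∀ i j → 0# ≤ A i j
    0≤A i j with A-01 i j
    ... | inj₁ A≈0 = ≤-reflexive (sym A≈0)
    ... | inj₂ A≈1 = ≤-trans 0≤1 (≤-reflexive (sym A≈1))

    A≤1 : ∀ i j → A i j ≤ 1#
    A≤1 i j with A-01 i j
    ... | inj₁ A≈0 = ≤-trans (≤-reflexive A≈0) 0≤1
    ... | inj₂ A≈1 = ≤-reflexive A≈1

    -- Both 0 and 1 are idempotent; this supplies as many copies of an entry as Hölder's inequality
    -- calls for.
    A^n≈A : ∀ k .{{_ : ℕ.NonZero k}} i j → A i j ^ k ≈ A i j
    A^n≈A k i j with A-01 i j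
    ... | inj₁ A≈0 = trans (^-congˡ k A≈0) (trans (0^n≈0 k) (sym A≈0))
    ... | inj₂ A≈1 = trans (^-congˡ k A≈1) (trans (1^n≈1 k) (sym A≈1))

    entrySum : Carrier
    entrySum = sum λ i → sum λ j → A i j

    entrySum-nonNeg : 0# ≤ entrySum
    entrySum-nonNeg = sum-nonNeg λ i → sum-nonNeg λ j → 0≤A i j

    -- Jensen's inequality for the power (q + e) / e, averaging over the entries 1 of A.
    quadraticForm-jensen : ∀ e q .{{_ : ℕ.NonZero e}} {w : Vector Carrier n} → (∀ i → 0# ≤ w i) →
      quadraticForm A (λ i → w i ^ e) ^ (q ℕ.+ e) ≤
      quadraticForm A (λ i → w i ^ (q ℕ.+ e)) ^ e * entrySum ^ q
    quadraticForm-jensen e@(suc e-1) q {w} 0≤w = begin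
      quadraticForm A (λ i → w i ^ e) ^ m
        ≈⟨ ^-congˡ m (trans (quadraticForm-double A (λ i → w i ^ e)) (sum-cong-≋ λ i → sum-cong-≋ λ j → begin-equality
             -- The entry becomes A^q Aᵉ: Aᵉ is absorbed into the e-th power of
             -- `A i j * (w j * w i)`, and A^q is the weight, summing to `entrySum`.
             A i j * (w j ^ e * w i ^ e)               ≈⟨ *-congʳ (trans (sym (A^n≈A m i j)) (^-homo-* (A i j) q e)) ⟩
             A i j ^ q * A i j ^ e * (w j ^ e * w i ^ e) ≈⟨ solve 4 (λ a b x y → a :* b :* (x :* y) := b :* (x :* y) :* a) refl (A i j ^ q) (A i j ^ e) (w j ^ e) (w i ^ e) ⟩
             A i j ^ e * (w j ^ e * w i ^ e) * A i j ^ q ≈⟨ *-congʳ (scaled-^ e i j) ⟨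
             (A i j * (w j * w i)) ^ e * A i j ^ q     ∎)) ⟩
      (sum λ i → sum λ j → (A i j * (w j * w i)) ^ e * A i j ^ q) ^ m
        ≤⟨ hölder₂ e q (λ i j → *-nonNegative (0≤A i j) (*-nonNegative (0≤w j) (0≤w i))) 0≤A ⟩
      (sum λ i → sum λ j → (A i j * (w j * w i)) ^ m) ^ e * (sum λ i → sum λ j → A i j ^ m) ^ q
        ≈⟨ *-cong
             (^-congˡ e (trans (sum-cong-≋ λ i → sum-cong-≋ λ j → trans (scaled-^ m i j) (*-congʳ (A^n≈A m i j)))
               (sym (quadraticForm-double A (λ i → w i ^ m)))))
             (^-congˡ q (sum-cong-≋ λ i → sum-cong-≋ λ j → A^n≈A m i j)) ⟩
      quadraticForm A (λ i → w i ^ m) ^ e * entrySum ^ q ∎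
      where
      m = q ℕ.+ e
      instance
        m≢0 : ℕ.NonZero m
        m≢0 = ℕ.>-nonZero (ℕ.m≤n⇒m≤o+n q (ℕ.s≤s ℕ.z≤n))
      scaled-^ : ∀ k i j → (A i j * (w j * w i)) ^ k ≈ A i j ^ k * (w j ^ k * w i ^ k)
      scaled-^ k i j = trans (^-distrib-* (A i j) _ k) (*-congˡ (^-distrib-* (w j) (w i) k))

    module _ (e v q : ℕ) {m N : ℕ}
             .{{e≢0 : ℕ.NonZero e}} .{{v≢0 : ℕ.NonZero v}} .{{m≢0 : ℕ.NonZero m}} .{{N≢0 : ℕ.NonZero N}}
             .{{p≢0 : ℚ.NonZero ((+ N) ℚ./ m)}} .{{r≢0 : ℚ.NonZero ((+ N) ℚ./ v)}}
             (m+v≡N : m ℕ.+ v ≡ N) (q+e≡m : q ℕ.+ e ≡ m) (2e≡N : 2 ℕ.* e ≡ N) where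

      private
        p = (+ N) ℚ./ m
        r = (+ N) ℚ./ v
        K = opNorm p r A

      quadraticForm≤ : ∀ {x : Vector Carrier n} → (∀ i → 0# ≤ x i) → ¬ (∀ i → x i ≈ 0#) →
                       quadraticForm A x ≤ K * (norm p x * norm p x)
      quadraticForm≤ {x} 0≤x x≉0 = begin
        quadraticForm A x             ≤⟨ hölder-norm m v m+v≡N (λ i → sum-nonNeg λ j → *-nonNegative (0≤A i j) (0≤x j)) 0≤x ⟩
        norm r (A *ᵥ x) * norm p x    ≤⟨ *-monoˡ-≤ (norm-nonNeg N m x)
                                           (norm-*ᵥ≤opNorm N m v (ℕ.m+n≤o⇒n≤o m (ℕ.≤-reflexive m+v≡N)) 0≤A A≤1 x≉0) ⟩
        K * norm p x * norm p x       ≈⟨ *-assoc _ _ _ ⟩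
        K * (norm p x * norm p x)     ∎

      -- The test vector is ∣x∣ ^ (m / e), whose p-norm is a power of the 2-norm of x.
      real-eigenvalue-bound : ∀ {a x} → ¬ (∀ i → x i ≈ 0#) → (∀ i → (A *ᵥ x) i ≈ a * x i) →
                              ∣ a ∣ ^ m ≤ K ^ e * entrySum ^ q
      real-eigenvalue-bound {a} {x} x≉0 Ax≈ax = *-cancelʳ-≤ (^-pos m 0<U) $ begin
        ∣ a ∣ ^ m * U ^ m                            ≈⟨ ^-distrib-* ∣ a ∣ U m ⟨
        (∣ a ∣ * U) ^ m                              ≤⟨ ^-mono-≤ m (*-nonNegative (∣x∣-nonNeg a) (<⇒≤ 0<U)) aU≤ ⟩
        quadraticForm A u ^ m                        ≈⟨ ^-congˡ m (sum-cong-≋ λ i → *-cong (sum-cong-≋ λ j → *-congˡ (sym (wᵉ≈u j))) (sym (wᵉ≈u i))) ⟩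
        quadraticForm A (λ i → w i ^ e) ^ m          ≤⟨ jensen q+e≡m ⟩
        quadraticForm A W ^ e * entrySum ^ q         ≤⟨ *-monoˡ-≤ (^-nonNeg q entrySum-nonNeg) (^-mono-≤ e
                                                          (sum-nonNeg λ i → *-nonNegative (sum-nonNeg λ j → *-nonNegative (0≤A i j) (0≤W j)) (0≤W i))
                                                          (quadraticForm≤ 0≤W W≉0)) ⟩
        (K * (norm p W * norm p W)) ^ e * entrySum ^ q ≈⟨ *-congʳ (trans (^-distrib-* K _ e) (*-congˡ normW)) ⟩
        K ^ e * U ^ m * entrySum ^ q                 ≈⟨ solve 3 (λ k u t → k :* u :* t := k :* t :* u) refl (K ^ e) (U ^ m) (entrySum ^ q) ⟩
        K ^ e * entrySum ^ q * U ^ m                 ∎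
        where
        u w W : Vector Carrier n
        u i = ∣ x i ∣
        w i = root e (u i)
        W i = w i ^ m
        U = sum λ i → u i * u i
        0<U : 0# < U
        0<U = ∑x²-pos λ u≈0 → x≉0 λ i → ∣x∣≈0⇒x≈0 (u≈0 i)
        wᵉ≈u : ∀ i → w i ^ e ≈ u i
        wᵉ≈u i = root-^ e (∣x∣-nonNeg (x i))
        0≤w : ∀ i → 0# ≤ w i
        0≤w i = root-nonNeg e (∣x∣-nonNeg (x i))
        0≤W : ∀ i → 0# ≤ W i
        0≤W i = ^-nonNeg m (0≤w i)
        W≉0 : ¬ (∀ i → W i ≈ 0#)
        W≉0 W≈0 = x≉0 λ i → ∣x∣≈0⇒x≈0 (trans (sym (wᵉ≈u i))
          (trans (^-congˡ e (^-cancel-≈0 m (0≤w i) (W≈0 i))) (0^n≈0 e)))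
        aU≤ : ∣ a ∣ * U ≤ quadraticForm A u
        aU≤ = begin
          ∣ a ∣ * U                          ≈⟨ *-distribˡ-sum ∣ a ∣ (λ i → u i * u i) ⟩
          (sum λ i → ∣ a ∣ * (u i * u i))    ≤⟨ sum-mono-≤ (λ i → begin
            ∣ a ∣ * (u i * u i)  ≈⟨ *-assoc ∣ a ∣ (u i) (u i) ⟨
            ∣ a ∣ * u i * u i    ≤⟨ *-monoˡ-≤ (∣x∣-nonNeg (x i)) (∣a∣u≤Au i) ⟩
            (A *ᵥ u) i * u i     ∎) ⟩
          quadraticForm A u                  ∎
          where
          ∣a∣u≤Au : ∀ i → ∣ a ∣ * u i ≤ (A *ᵥ u) i
          ∣a∣u≤Au i = begin
            ∣ a ∣ * ∣ x i ∣  ≤⟨ ∣∣-* a (x i) ⟩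
            ∣ a * x i ∣      ≤⟨ ∣∣-mono (sym (Ax≈ax i)) ⟩
            ∣ (A *ᵥ x) i ∣   ≤⟨ ∣*ᵥ∣≤ 0≤A x i ⟩
            (A *ᵥ u) i       ∎
            where
            ∣∣-mono : ∀ {x y} → x ≈ y → ∣ x ∣ ≤ ∣ y ∣
            ∣∣-mono {x} {y} x≈y = ∣x∣≤ (≤-trans (≤-reflexive x≈y) (x≤∣x∣ y))
                                       (≤-trans (≤-reflexive (-‿cong x≈y)) (-x≤∣x∣ y))
        -- The exponent is a variable here so that the equation can be matched with `refl`; `m` is a
        -- fixed parameter of the module.
        jensen : ∀ {k} → q ℕ.+ e ≡ k → quadraticForm A (λ i → w i ^ e) ^ k ≤
                                       quadraticForm A (λ i → w i ^ k) ^ e * entrySum ^ q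
        jensen ≡.refl = quadraticForm-jensen e q 0≤w
        normW : (norm p W * norm p W) ^ e ≈ U ^ m
        normW = begin-equality
          (norm p W * norm p W) ^ e      ≈⟨ ^-congˡ e (*-congˡ (*-identityʳ _)) ⟨
          (norm p W ^ 2) ^ e             ≈⟨ trans (^-assocʳ _ 2 e) (^-congʳ _ 2e≡N) ⟩
          norm p W ^ N                   ≈⟨ norm-^-power N m 0≤w (λ _ → refl) ⟩
          (sum λ i → w i ^ N) ^ m        ≈⟨ ^-congˡ m (sum-cong-≋ λ i → begin-equality
            -- Here N = 2e enters: w to the power N is the square of wᵉ = u, so the p-norm of `W`
            -- leads to the 2-norm of `x`.
            w i ^ N            ≈⟨ trans (^-congʳ (w i) (≡.trans (≡.sym 2e≡N) (ℕ.*-comm 2 e))) (sym (^-assocʳ (w i) e 2)) ⟩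
            (w i ^ e) ^ 2      ≈⟨ *-congˡ (*-identityʳ _) ⟩
            w i ^ e * w i ^ e  ≈⟨ *-cong (wᵉ≈u i) (wᵉ≈u i) ⟩
            u i * u i          ∎) ⟩
          U ^ m                          ∎

    -- Pairing A x with y gives a P - b Y, and pairing A y with x gives b X + a P. Symmetry makes
    -- these equal, so b (X + Y) = 0; for b ≠ 0 both squared norms vanish, and with them the
    -- eigenvector.
    eigenvalue-real : ∀ {a b} → IsEigenvalue A a b → b ≈ 0#
    eigenvalue-real {a} {b} (x , y , xy≉0 , Ax , Ay) with b ≟ 0#
    ... | yes b≈0 = b≈0
    ... | no  b≉0 = contradiction (x≈0 , y≈0) xy≉0
      where
      X = sum λ i → x i * x i
      Y = sum λ i → y i * y i
      P = sum λ i → x i * y i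
      b[X+Y]≈0 : b * (X + Y) ≈ 0#
      b[X+Y]≈0 = begin-equality
        b * (X + Y)                                             ≈⟨ x+y-y≈x _ (a * P) ⟨
        b * (X + Y) + a * P + - (a * P)                         ≈⟨ +-congʳ (solve 5 (λ b x y a p → b :* (x :+ y) :+ a :* p := (b :* x :+ a :* p) :+ b :* y) refl b X Y a P) ⟩
        ((b * X + a * P) + b * Y) + - (a * P)                   ≈⟨ +-congʳ (+-congʳ (trans bX+aP (*ᵥ-selfAdjoint A-sym y x))) ⟩
        ((sum λ i → (A *ᵥ x) i * y i) + b * Y) + - (a * P)      ≈⟨ +-congʳ aP ⟩
        a * P + - (a * P)                                       ≈⟨ -‿inverseʳ _ ⟩
        0#                                                      ∎
        where
        bX+aP : b * X + a * P ≈ (sum λ i → (A *ᵥ y) i * x i)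
        bX+aP = begin-equality
          b * X + a * P
            ≈⟨ +-cong (*-distribˡ-sum b (λ i → x i * x i)) (*-distribˡ-sum a (λ i → x i * y i)) ⟩
          (sum λ i → b * (x i * x i)) + (sum λ i → a * (x i * y i))
            ≈⟨ ∑-distrib-+ (λ i → b * (x i * x i)) (λ i → a * (x i * y i)) ⟨
          (sum λ i → b * (x i * x i) + a * (x i * y i))
            ≈⟨ sum-cong-≋ (λ i → trans
                 (solve 4 (λ b x a y → b :* (x :* x) :+ a :* (x :* y) := (b :* x :+ a :* y) :* x) refl b (x i) a (y i))
                 (*-congʳ (sym (Ay i)))) ⟩
          (sum λ i → (A *ᵥ y) i * x i) ∎
        aP : (sum λ i → (A *ᵥ x) i * y i) + b * Y ≈ a * P
        aP = begin-equality
          (sum λ i → (A *ᵥ x) i * y i) + b * Y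
            ≈⟨ +-congˡ (*-distribˡ-sum b (λ i → y i * y i)) ⟩
          (sum λ i → (A *ᵥ x) i * y i) + (sum λ i → b * (y i * y i))
            ≈⟨ ∑-distrib-+ (λ i → (A *ᵥ x) i * y i) (λ i → b * (y i * y i)) ⟨
          (sum λ i → (A *ᵥ x) i * y i + b * (y i * y i))
            ≈⟨ sum-cong-≋ (λ i → trans
                 (solve 3 (λ z b y → z :* y :+ b :* (y :* y) := (z :+ b :* y) :* y) refl ((A *ᵥ x) i) b (y i))
                 (trans (*-congʳ (trans (+-congʳ (Ax i)) (x-y+y≈x _ _))) (*-assoc a (x i) (y i)))) ⟩
          (sum λ i → a * (x i * y i))
            ≈⟨ *-distribˡ-sum a (λ i → x i * y i) ⟨
          a * P ∎
      0≤X : 0# ≤ X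
      0≤X = sum-nonNeg λ i → square-nonNeg (x i)
      0≤Y : 0# ≤ Y
      0≤Y = sum-nonNeg λ i → square-nonNeg (y i)
      X+Y≤0 : X + Y ≤ 0#
      X+Y≤0 = begin
        X + Y                ≈⟨ *-identityˡ _ ⟨
        1# * (X + Y)         ≈⟨ *-congʳ (trans (*-comm _ b) (*-inverseʳ b≉0)) ⟨
        b ⁻¹ * b * (X + Y)   ≈⟨ *-assoc _ _ _ ⟩
        b ⁻¹ * (b * (X + Y)) ≈⟨ trans (*-congˡ b[X+Y]≈0) (zeroʳ _) ⟩
        0#                   ∎
      ∑x²≤0⇒x≈0 : ∀ {x : Vector Carrier n} → (sum λ i → x i * x i) ≤ 0# → ∀ i → x i ≈ 0#
      ∑x²≤0⇒x≈0 {x} Σ≤0 with Fin.all? (λ i → x i ≟ 0#)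
      ... | yes x≈0 = x≈0
      ... | no  x≉0 = contradiction Σ≤0 (∑x²-pos x≉0)
      x≈0 : ∀ i → x i ≈ 0#
      x≈0 = ∑x²≤0⇒x≈0 (≤-trans (x≤x+y 0≤Y) X+Y≤0)
      y≈0 : ∀ i → y i ≈ 0#
      y≈0 = ∑x²≤0⇒x≈0 (≤-trans (x≤y+x 0≤X) X+Y≤0)

    -- With b = 0 the real and the imaginary part satisfy the eigenvalue equation separately;
    -- decidable equality of their entries selects a nonzero one.
    realEigenvector : ∀ {a b} → IsEigenvalue A a b →
                      ∃[ x ] ¬ (∀ i → x i ≈ 0#) × (∀ i → (A *ᵥ x) i ≈ a * x i)
    realEigenvector {a} {b} ev@(x , y , xy≉0 , Ax , Ay) with Fin.all? (λ i → x i ≟ 0#)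
    ... | no  x≉0 = x , x≉0 , λ i → begin-equality
      (A *ᵥ x) i           ≈⟨ Ax i ⟩
      a * x i + - (b * y i) ≈⟨ +-congˡ (trans (-‿cong (b*≈0 (y i))) -0#≈0#) ⟩
      a * x i + 0#         ≈⟨ +-identityʳ _ ⟩
      a * x i              ∎
      where
      b*≈0 : ∀ z → b * z ≈ 0#
      b*≈0 z = trans (*-congʳ (eigenvalue-real ev)) (zeroˡ z)
    ... | yes x≈0 = y , (λ y≈0 → xy≉0 (x≈0 , y≈0)) , λ i → begin-equality
      (A *ᵥ y) i         ≈⟨ Ay i ⟩
      b * x i + a * y i  ≈⟨ +-congʳ (trans (*-congˡ (x≈0 i)) (zeroʳ b)) ⟩
      0# + a * y i       ≈⟨ +-identityˡ _ ⟩
      a * y i            ∎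

    spectralRadius-^≤ : ∀ m .{{_ : ℕ.NonZero m}} {c} → 0# ≤ c →
      (∀ {a x} → ¬ (∀ i → x i ≈ 0#) → (∀ i → (A *ᵥ x) i ≈ a * x i) → ∣ a ∣ ^ m ≤ c) →
      spectralRadius A ^ m ≤ c
    spectralRadius-^≤ m {c} 0≤c ∣a∣ᵐ≤c = begin
      -- The adjoined 0 makes the supremum nonnegative, as monotonicity of the m-th power requires.
      spectralRadius A ^ m  ≤⟨ ^-mono-≤ m (proj₁ lub (inj₁ refl)) (proj₂ lub bound) ⟩
      root m c ^ m          ≈⟨ root-^ m 0≤c ⟩
      c                     ∎
      where
      Moduli : Carrier → Set
      Moduli t = t ≈ 0# ⊎ (∃[ a ] ∃[ b ] IsEigenvalue A a b × t ≈ root 2 (a ^ 2 + b ^ 2))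
      bound : IsUpperBound Moduli (root m c)
      bound (inj₁ t≈0) = ≤-trans (≤-reflexive t≈0) (root-nonNeg m 0≤c)
      bound {t} (inj₂ (a , b , ev , t≈)) with x , x≉0 , Ax≈ax ← realEigenvector ev = begin
        t                       ≈⟨ t≈ ⟩
        root 2 (a ^ 2 + b ^ 2)  ≤⟨ ^-cancel-≤ 2 (∣x∣-nonNeg a) (≤-reflexive modulus²) ⟩
        ∣ a ∣                   ≤⟨ ^-cancel-≤ m (root-nonNeg m 0≤c)
                                     (≤-trans (∣a∣ᵐ≤c x≉0 Ax≈ax) (≤-reflexive (sym (root-^ m 0≤c)))) ⟩
        root m c                ∎
        where
        square : ∀ x → x ^ 2 ≈ x * x
        square x = *-congˡ (*-identityʳ x)
        modulus² : root 2 (a ^ 2 + b ^ 2) ^ 2 ≈ ∣ a ∣ ^ 2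
        modulus² = begin-equality
          root 2 (a ^ 2 + b ^ 2) ^ 2 ≈⟨ root-^ 2 (+-nonNeg (≤-trans (square-nonNeg a) (≤-reflexive (sym (square a))))
                                                           (≤-trans (square-nonNeg b) (≤-reflexive (sym (square b))))) ⟩
          a ^ 2 + b ^ 2              ≈⟨ +-congˡ (trans (^-congˡ 2 (eigenvalue-real ev)) (0^n≈0 2)) ⟩
          a ^ 2 + 0#                 ≈⟨ +-identityʳ _ ⟩
          a ^ 2                      ≈⟨ square a ⟩
          a * a                      ≈⟨ ∣x∣*∣x∣≈x*x a ⟨
          ∣ a ∣ * ∣ a ∣              ≈⟨ square ∣ a ∣ ⟨
          ∣ a ∣ ^ 2                  ∎
      lub = sup-complete Moduli (0# , inj₁ refl) (root m c , bound)

-- The handshake identity: the entries of the adjacency matrix sum to twice the number of edges.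

module AdjacencyMatrix (ℝ : CompleteOrderedField) where
  open OrderedField ℝ

  indicator : ∀ {P : Set} → Dec P → Carrier
  indicator P? = if does P? then 1# else 0#

  indicator-yes : ∀ {P : Set} (P? : Dec P) → P → indicator P? ≈ 1#
  indicator-yes P? p = reflexive (≡.cong (if_then 1# else 0#) (dec-true P? p))

  indicator-no : ∀ {P : Set} (P? : Dec P) → ¬ P → indicator P? ≈ 0#
  indicator-no P? ¬p = reflexive (≡.cong (if_then 1# else 0#) (dec-false P? ¬p))

  module _ {A : Set} {P : A → Set} (P? : ∀ x → Dec (P x)) where

    length-filter-tabulate : ∀ {n} (f : Fin n → A) →
      fromℕ (length (filter P? (tabulate f))) ≈ (sum λ i → indicator (P? (f i)))
    length-filter-tabulate {zero}  f = refl
    length-filter-tabulate {suc n} f with does (P? (f zero))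
    ... | true  = +-congˡ (length-filter-tabulate (f ∘ suc))
    ... | false = trans (length-filter-tabulate (f ∘ suc)) (sym (+-identityˡ _))

  -- The first factor is `tabulate f` because the induction passes to the tail of the enumeration;
  -- `f = id` recovers `allFin`.
  length-filter-cartesianProduct :
    ∀ {A : Set} {n} {P : A × Fin n → Set} (P? : ∀ x → Dec (P x)) {k} (f : Fin k → A) →
    fromℕ (length (filter P? (cartesianProduct (tabulate f) (allFin n)))) ≈
    (sum λ i → sum λ j → indicator (P? (f i , j)))
  length-filter-cartesianProduct P? {zero}  f = refl
  length-filter-cartesianProduct {n = n} P? {suc k} f = begin-equality
    fromℕ (length (filter P? (row List.++ rest)))
      ≡⟨ ≡.cong (fromℕ ∘ length) (List.filter-++ P? row rest) ⟩
    fromℕ (length (filter P? row List.++ filter P? rest))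
      ≡⟨ ≡.cong fromℕ (List.length-++ (filter P? row)) ⟩
    fromℕ (length (filter P? row) ℕ.+ length (filter P? rest))
      ≈⟨ fromℕ-+ (length (filter P? row)) _ ⟩
    fromℕ (length (filter P? row)) + fromℕ (length (filter P? rest))
      ≡⟨ ≡.cong (λ xs → fromℕ (length (filter P? xs)) + fromℕ (length (filter P? rest))) (List.map-tabulate id (f zero ,_)) ⟩
    fromℕ (length (filter P? (tabulate (f zero ,_)))) + fromℕ (length (filter P? rest))
      ≈⟨ +-cong (length-filter-tabulate P? (f zero ,_)) (length-filter-cartesianProduct P? (f ∘ suc)) ⟩
    (sum λ i → sum λ j → indicator (P? (f i , j))) ∎
    where
    row = List.map (f zero ,_) (allFin n)
    rest = cartesianProduct (tabulate (f ∘ suc)) (allFin n)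

  module _ (G : Graph) where
    open Graph G using (_∼_; _∼?_; ∼-sym; ∼-irrefl)

    private
      A = adjacency G

    adjacency-01 : ∀ i j → A i j ≈ 0# ⊎ A i j ≈ 1#
    adjacency-01 i j with does (i ∼? j)
    ... | true  = inj₂ refl
    ... | false = inj₁ refl

    adjacency-sym : ∀ i j → A i j ≈ A j i
    adjacency-sym i j with i ∼? j | j ∼? i
    ... | yes _   | yes _   = refl
    ... | no _    | no _    = refl
    ... | yes i∼j | no j≁i  = contradiction (∼-sym i∼j) j≁i
    ... | no i≁j  | yes j∼i = contradiction (∼-sym j∼i) i≁j

    -- The edge test of `size` is repeated verbatim, so that `size G` unfolds to a count with
    -- `upper?`.
    upper? : ∀ ((i , j) : Fin (order G) × Fin (order G)) → Dec (i Fin.< j × i ∼ j)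
    upper? (i , j) = (i Fin.<? j) ×-dec (i ∼? j)

    upper : Matrix (order G)
    upper i j = indicator (upper? (i , j))

    -- An edge is counted in exactly one of its two orientations, and irreflexivity excludes the
    -- diagonal. Summed over all pairs, the two terms contribute `size G` each.
    adjacency-upper : ∀ i j → A i j ≈ upper i j + upper j i
    adjacency-upper i j = byCases (i ∼? j) (Fin.<-cmp i j)
      where
      byCases : Dec (i ∼ j) → Tri (i Fin.< j) (i ≡ j) (j Fin.< i) → A i j ≈ upper i j + upper j i
      byCases (no i≁j) _ = begin-equality
        A i j                  ≈⟨ indicator-no (i ∼? j) i≁j ⟩
        0#                     ≈⟨ +-identityˡ 0# ⟨
        0# + 0#                ≈⟨ +-cong (indicator-no (upper? (i , j)) (i≁j ∘ proj₂)) (indicator-no (upper? (j , i)) (i≁j ∘ ∼-sym ∘ proj₂)) ⟨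
        upper i j + upper j i  ∎
      byCases (yes i∼j) (tri< i<j _ j≮i) = begin-equality
        A i j                  ≈⟨ indicator-yes (i ∼? j) i∼j ⟩
        1#                     ≈⟨ +-identityʳ 1# ⟨
        1# + 0#                ≈⟨ +-cong (indicator-yes (upper? (i , j)) (i<j , i∼j)) (indicator-no (upper? (j , i)) (j≮i ∘ proj₁)) ⟨
        upper i j + upper j i  ∎
      byCases (yes i∼j) (tri> i≮j _ j<i) = begin-equality
        A i j                  ≈⟨ indicator-yes (i ∼? j) i∼j ⟩
        1#                     ≈⟨ +-identityˡ 1# ⟨
        0# + 1#                ≈⟨ +-cong (indicator-no (upper? (i , j)) (i≮j ∘ proj₁)) (indicator-yes (upper? (j , i)) (j<i , ∼-sym i∼j)) ⟨
        upper i j + upper j i  ∎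
      byCases (yes i∼j) (tri≈ _ ≡.refl _) = contradiction i∼j ∼-irrefl

    ∑adjacency≈M : (sum λ i → sum λ j → A i j) ≈ fromℕ (M G)
    ∑adjacency≈M = begin-equality
      (sum λ i → sum λ j → A i j)
        ≈⟨ sum-cong-≋ (λ i → trans (sum-cong-≋ (adjacency-upper i)) (∑-distrib-+ (upper i) (λ j → upper j i))) ⟩
      (sum λ i → sum (upper i) + sum λ j → upper j i)
        ≈⟨ ∑-distrib-+ (λ i → sum (upper i)) (λ i → sum λ j → upper j i) ⟩
      S + (sum λ i → sum λ j → upper j i)
        ≈⟨ +-congˡ (∑-comm upper) ⟨
      S + S
        ≈⟨ +-cong size≈S size≈S ⟨
      fromℕ (size G) + fromℕ (size G)
        ≈⟨ fromℕ-+ (size G) (size G) ⟨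
      fromℕ (size G ℕ.+ size G)
        ≡⟨ ≡.cong (λ k → fromℕ (size G ℕ.+ k)) (ℕ.+-identityʳ (size G)) ⟨
      fromℕ (M G) ∎
      where
      S = sum λ i → sum (upper i)
      size≈S : fromℕ (size G) ≈ S
      size≈S = length-filter-cartesianProduct upper? id

-- Passing from the eigenvalue bound to homomorphism counts.

lemma2p3 : (ℝ : CompleteOrderedField) → let open Analysis ℝ in
    (H : Graph) → Bipartite H → (v≤e : order H ℕ.≤ size H) →
    Certificate H (v≤e⇒v<2e H v≤e) →
    (G : Graph) → 0 ℕ.< M G →
    spectralRadius (adjacency G) ^ (2 ℕ.* size H ℕ.∸ order H)
    * fromℕ (M G) ^ℤ (+ order H ℤ.- + size H)
    ≤ fromℕ (hom H G)
lemma2p3 ℝ H _ v≤e certificate G 0<M = begin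
  λᴳ ^ m * T ^ℤ (+ v ℤ.- + e)                 ≡⟨ ≡.cong (λ k → λᴳ ^ m * T ^ℤ k) (≡.trans (ℤ.m-n≡m⊖n v e) (ℤ.⊖-≤ v≤e)) ⟩
  -- The exponent v - e is minus the natural number q, so multiplying by T^q, with T > 0 from the
  -- edges of `G`, clears the negative power.
  λᴳ ^ m * T ^ℤ (ℤ.- (+ q))                   ≤⟨ *-cancelʳ-≤ (^-pos q 0<T) (begin
    λᴳ ^ m * T ^ℤ (ℤ.- (+ q)) * T ^ q         ≈⟨ *-assoc _ _ _ ⟩
    λᴳ ^ m * (T ^ℤ (ℤ.- (+ q)) * T ^ q)       ≈⟨ trans (*-congˡ (^ℤ-inverse q 0<T)) (*-identityʳ _) ⟩
    λᴳ ^ m                                    ≤⟨ spectralRadius-^≤ m (*-nonNegative (fromℕ-nonNeg (hom H G)) (<⇒≤ (^-pos q 0<T))) eigenvalue≤ ⟩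
    fromℕ (hom H G) * T ^ q                   ∎) ⟩
  fromℕ (hom H G)                             ∎
  where
  open OrderedField ℝ
  open Norms ℝ
  open Spectral ℝ
  open AdjacencyMatrix ℝ
  e = size H
  v = order H
  m = 2 ℕ.* e ℕ.∸ v
  q = e ℕ.∸ v
  T = fromℕ (M G)
  λᴳ = spectralRadius (adjacency G)
  v<2e = v≤e⇒v<2e H v≤e
  instance
    n≢0 : ℕ.NonZero (order G)
    n≢0 = Graph.order-nonZero G
    v≢0 : ℕ.NonZero v
    v≢0 = Graph.order-nonZero H
    e≢0 : ℕ.NonZero e
    e≢0 = ℕ.>-nonZero (ℕ.≤-trans (ℕ.>-nonZero⁻¹ v) v≤e)
    m≢0 : ℕ.NonZero m
    m≢0 = ℕ.>-nonZero (ℕ.m<n⇒0<n∸m v<2e)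
    N≢0 : ℕ.NonZero (2 ℕ.* e)
    N≢0 = ℕ.>-nonZero (ℕ.≤-<-trans ℕ.z≤n v<2e)
    s≢0 = /-nonZero (2 ℕ.* e) v
    s′≢0 = /-nonZero (2 ℕ.* e) m
  0<T : 0# < T
  0<T = fromℕ-pos (M G) {{ℕ.>-nonZero 0<M}}
  open ZeroOneMatrix (adjacency-01 G) (adjacency-sym G)
  q+e≡m : q ℕ.+ e ≡ m
  -- `2 * e` unfolds to `e + (e + 0)`, whence the correction by the identity law.
  q+e≡m = ≡.trans (≡.sym (ℕ.+-∸-comm e v≤e)) (≡.cong (λ k → e ℕ.+ k ℕ.∸ v) (≡.sym (ℕ.+-identityʳ e)))
  eigenvalue≤ : ∀ {a x} → ¬ (∀ i → x i ≈ 0#) → (∀ i → (adjacency G *ᵥ x) i ≈ a * x i) →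
                ∣ a ∣ ^ m ≤ fromℕ (hom H G) * T ^ q
  eigenvalue≤ {a} x≉0 Ax≈ax = begin
    -- With N = 2e, the exponents N/m and N/v unfold to `s′Exp` and `sExp`, so the bound speaks of
    -- the operator norm in the certificate.
    ∣ a ∣ ^ m                                        ≤⟨ real-eigenvalue-bound e v q (ℕ.m∸n+n≡m (ℕ.<⇒≤ v<2e)) q+e≡m ≡.refl x≉0 Ax≈ax ⟩
    opNorm (s′Exp H v<2e) (sExp H) (adjacency G) ^ e * entrySum ^ q
      ≤⟨ *-monoˡ-≤ (^-nonNeg q entrySum-nonNeg) (certificate G) ⟩
    fromℕ (hom H G) * entrySum ^ q                   ≈⟨ *-congˡ (^-congˡ q (∑adjacency≈M G)) ⟩
    fromℕ (hom H G) * T ^ q                          ∎
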